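{- The Dominating Set Reconfiguration problem (DSR) parameterized by $k+d$ is fixed-parameter tractable on graphs that exclude $K_{d,d}$ as a subgraph. That is, the problem whose inputs are a graph $G$ not containing $K_{d,d}$ as a (not necessarily induced) subgraph (with $d$ given), a positive integer $k$, and two dominating sets $D_s,D_t$ of $G$ with $|D_s|=|D_t|=k$, and which asks whether there is a path from $D_s$ to $D_t$ in the reconfiguration graph $R_{\mathrm{DS}}(G,k,k+1)$, is fixed-parameter tractable with parameter $k+d$.
   Context: Graphs are finite, simple and undirected. $K_{d,d}$ is the complete bipartite graph with $d$ vertices on each side, $d>0$. A set $D\subseteq V(G)$ is a dominating set of $G$ if every vertex of $G$ is in $D$ or has a neighbor in $D$. The reconfiguration graph $R_{\mathrm{DS}}(G,k,k+1)$ has one node for each dominating set of $G$ of size $k$ or $k+1$; two nodes $A,B$ are adjacent iff $|A \mathbin{\Delta} B| = 1$ (symmetric difference). DSR: given $G$, $k$, and two dominating sets $D_s,D_t$ of $G$ of size $k$, decide whether there is a path from $D_s$ to $D_t$ in $R_{\mathrm{DS}}(G,k,k+1)$. A parameterized problem with inputs $(x,p)$, $|x|=n$, $p$ a positive integer, is fixed-parameter tractable if it can be decided in time $f(p)\,n^c$, where $f$ is an arbitrary function and $c$ is a constant independent of $n$ and $p$. -}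

module Defs where

open import Data.Bool using (Bool; true; false; if_then_else_)
open import Data.Fin using (Fin; splitAt)
open import Data.Fin.Subset using (Subset; _∈_; _∪_; _─_; ∣_∣)
open import Data.List using (List; []; _∷_; allFin)
open import Data.Nat using (ℕ; zero; suc; _+_; _*_; _^_; _≤_; _<_; _≟_)
open import Data.Nat.Properties using (≤-trans; m≤m+n)
open import Data.Product using (Σ-syntax; ∃-syntax; _×_)
open import Data.Sum using (_⊎_; inj₁; inj₂)
open import Data.Vec using (toList)
open import Function.Definitions using (Injective)
open import Relation.Binary.Construct.Closure.ReflexiveTransitive using (Star)
open import Relation.Binary.PropositionalEquality using (_≡_; _≢_; refl)
open import Relation.Nullary using (¬_; does)
open import Relation.Nullary.Reflects using (Reflects)

------------------------------------------------------------------------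
-- Model of computation
--
-- The language WHILE of N. D. Jones (Computability and Complexity from a
-- Programming Perspective, MIT Press, 1997), with a conditional added:
-- imperative programs over binary trees.  Evaluating any of nil, a
-- variable, cons, hd, tl costs one time unit, and so does each assignment
-- and each test.  Trees may be shared in memory, so each of these is a
-- constant number of pointer operations; the model is polynomial-time
-- equivalent to Turing machines, in both directions.

infixr 5 _∙_

data Tree : Set where
  nil : Tree
  _∙_ : Tree → Tree → Tree

size : Tree → ℕ
size nil     = 1
size (s ∙ t) = suc (size s + size t)

data Expr : Set where
  var  : ℕ → Expr
  nil  : Expr
  cons : Expr → Expr → Expr
  hd   : Expr → Expr
  tl   : Expr → Expr

infix  6 _≔_
infixr 5 _⨾_

data Command : Set where
  _≔_   : ℕ → Expr → Command
  _⨾_   : Command → Command → Command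
  ite   : Expr → Command → Command → Command
  while : Expr → Command → Command

Store : Set
Store = ℕ → Tree

_[_↦_] : Store → ℕ → Tree → Store
(σ [ x ↦ t ]) y = if does (x ≟ y) then t else σ y

head tail : Tree → Tree
head nil     = nil
head (s ∙ t) = s
tail nil     = nil
tail (s ∙ t) = t

eval : Expr → Store → Tree
eval (var x)    σ = σ x
eval nil        σ = nil
eval (cons e f) σ = eval e σ ∙ eval f σ
eval (hd e)     σ = head (eval e σ)
eval (tl e)     σ = tail (eval e σ)

cost : Expr → ℕ
cost (var x)    = 1
cost nil        = 1
cost (cons e f) = suc (cost e + cost f)
cost (hd e)     = suc (cost e)
cost (tl e)     = suc (cost e)

-- ⟨ c , σ ⟩⇓ τ in-time t : started in store σ, the command c halts in
-- store τ after exactly t time units.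

infix 4 ⟨_,_⟩⇓_in-time_

data ⟨_,_⟩⇓_in-time_ : Command → Store → Store → ℕ → Set where

  assign : ∀ {x e σ} →
    ⟨ x ≔ e , σ ⟩⇓ σ [ x ↦ eval e σ ] in-time suc (cost e)

  seq : ∀ {c d σ τ υ s t} →
    ⟨ c , σ ⟩⇓ τ in-time s →
    ⟨ d , τ ⟩⇓ υ in-time t →
    ⟨ c ⨾ d , σ ⟩⇓ υ in-time s + t

  if-true : ∀ {e c d σ τ t} →
    eval e σ ≢ nil →
    ⟨ c , σ ⟩⇓ τ in-time t →
    ⟨ ite e c d , σ ⟩⇓ τ in-time suc (cost e + t)

  if-false : ∀ {e c d σ τ t} →
    eval e σ ≡ nil →
    ⟨ d , σ ⟩⇓ τ in-time t →
    ⟨ ite e c d , σ ⟩⇓ τ in-time suc (cost e + t)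

  while-true : ∀ {e c σ τ υ s t} →
    eval e σ ≢ nil →
    ⟨ c , σ ⟩⇓ τ in-time s →
    ⟨ while e c , τ ⟩⇓ υ in-time t →
    ⟨ while e c , σ ⟩⇓ υ in-time suc (cost e + (s + t))

  while-false : ∀ {e c σ} →
    eval e σ ≡ nil →
    ⟨ while e c , σ ⟩⇓ σ in-time suc (cost e)

-- The input is placed in variable 0, where the output is also read off.

initial : Tree → Store
initial input = (λ _ → nil) [ 0 ↦ input ]

------------------------------------------------------------------------
-- Encodings

encodeBool : Bool → Tree
encodeBool false = nil
encodeBool true  = nil ∙ nil

-- Unary; this only ever applies to parameters, on which the running time
-- may depend arbitrarily.
encodeℕ : ℕ → Tree
encodeℕ zero    = nil
encodeℕ (suc n) = nil ∙ encodeℕ n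

encodeList : ∀ {A : Set} → (A → Tree) → List A → Tree
encodeList enc []       = nil
encodeList enc (x ∷ xs) = enc x ∙ encodeList enc xs

------------------------------------------------------------------------
-- Fixed-parameter tractability

-- Instance comprises exactly the admissible inputs, so a program deciding
-- the problem may behave arbitrarily on any other tree.
record ParameterizedProblem : Set₁ where
  field
    Instance  : Set
    encode    : Instance → Tree
    parameter : Instance → ℕ
    positive  : ∀ x → 0 < parameter x
    Yes       : Instance → Set

FixedParameterTractable : ParameterizedProblem → Set
FixedParameterTractable P =
  Σ[ program ∈ Command ] Σ[ f ∈ (ℕ → ℕ) ] Σ[ c ∈ ℕ ] ∀ (x : Instance) →
    Σ[ σ ∈ Store ] Σ[ t ∈ ℕ ] Σ[ answer ∈ Bool ]
      ⟨ program , initial (encode x ∙ encodeℕ (parameter x)) ⟩⇓ σ in-time t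
      × σ 0 ≡ encodeBool answer
      × Reflects (Yes x) answer
      × t ≤ f (parameter x) * size (encode x) ^ c
  where open ParameterizedProblem P

------------------------------------------------------------------------
-- Graphs

record Graph : Set where
  field
    order       : ℕ
    adjacent    : Fin order → Fin order → Bool
    symmetric   : ∀ u v → adjacent u v ≡ adjacent v u
    irreflexive : ∀ v → adjacent v v ≡ false

  Vertex : Set
  Vertex = Fin order

  _~_ : Vertex → Vertex → Set
  u ~ v = adjacent u v ≡ true

  VertexSet : Set
  VertexSet = Subset order

open Graph using (Vertex; VertexSet)

_IsSubgraphOf_ : Graph → Graph → Set
H IsSubgraphOf G =
  Σ[ f ∈ (Vertex H → Vertex G) ]
    Injective _≡_ _≡_ f × (∀ u v → u H.~ v → f u G.~ f v)
  where
  module H = Graph H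
  module G = Graph G

acrossSides : ∀ {A B : Set} → A ⊎ B → A ⊎ B → Bool
acrossSides (inj₁ _) (inj₁ _) = false
acrossSides (inj₁ _) (inj₂ _) = true
acrossSides (inj₂ _) (inj₁ _) = true
acrossSides (inj₂ _) (inj₂ _) = false

acrossSides-sym : ∀ {A B : Set} (s t : A ⊎ B) → acrossSides s t ≡ acrossSides t s
acrossSides-sym (inj₁ _) (inj₁ _) = refl
acrossSides-sym (inj₁ _) (inj₂ _) = refl
acrossSides-sym (inj₂ _) (inj₁ _) = refl
acrossSides-sym (inj₂ _) (inj₂ _) = refl

acrossSides-irrefl : ∀ {A B : Set} (s : A ⊎ B) → acrossSides s s ≡ false
acrossSides-irrefl (inj₁ _) = refl
acrossSides-irrefl (inj₂ _) = refl

completeBipartite : ℕ → ℕ → Graph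
completeBipartite a b = record
  { order       = a + b
  ; adjacent    = λ u v → acrossSides (splitAt a u) (splitAt a v)
  ; symmetric   = λ u v → acrossSides-sym (splitAt a u) (splitAt a v)
  ; irreflexive = λ v → acrossSides-irrefl (splitAt a v)
  }

------------------------------------------------------------------------
-- Dominating sets and their reconfiguration

Dominating : (G : Graph) → VertexSet G → Set
Dominating G D = ∀ v → v ∈ D ⊎ (∃[ u ] u ∈ D × v ~ u)
  where open Graph G using (_~_)

_Δ_ : ∀ {n} → Subset n → Subset n → Subset n
A Δ B = (A ─ B) ∪ (B ─ A)

-- Nodes and edges of R_DS(G,k,k+1).
Node : (G : Graph) → ℕ → VertexSet G → Set
Node G k A = Dominating G A × (∣ A ∣ ≡ k ⊎ ∣ A ∣ ≡ suc k)

Edge : (G : Graph) → ℕ → VertexSet G → VertexSet G → Set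
Edge G k A B = Node G k A × Node G k B × ∣ A Δ B ∣ ≡ 1

-- When A is a node, this is the existence of a path from A to B in
-- R_DS(G,k,k+1); for other A the empty walk is included too.
Reachable : (G : Graph) → ℕ → VertexSet G → VertexSet G → Set
Reachable G k = Star (Edge G k)

record DSRInstance : Set where
  field
    G             : Graph
    d k           : ℕ
    d-positive    : 0 < d
    k-positive    : 0 < k
    excludes      : ¬ (completeBipartite d d IsSubgraphOf G)
    Ds Dt         : VertexSet G
    Ds-dominating : Dominating G Ds
    Dt-dominating : Dominating G Dt
    Ds-size       : ∣ Ds ∣ ≡ k
    Dt-size       : ∣ Dt ∣ ≡ k

-- Adjacency matrix, row by row.
encodeGraph : Graph → Tree
encodeGraph G =
  encodeList (λ u → encodeList (λ v → encodeBool (adjacent u v)) (allFin order))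
             (allFin order)
  where open Graph G

encodeSubset : ∀ {n} → Subset n → Tree
encodeSubset D = encodeList encodeBool (toList D)

encodeDSR : DSRInstance → Tree
encodeDSR I =
  encodeGraph G ∙ encodeℕ d ∙ encodeℕ k ∙ encodeSubset Ds ∙ encodeSubset Dt
  where open DSRInstance I

BicliqueFreeDSR : ParameterizedProblem
BicliqueFreeDSR = record
  { Instance  = DSRInstance
  ; encode    = encodeDSR
  ; parameter = λ I → DSRInstance.k I + DSRInstance.d I
  ; positive  = λ I → ≤-trans (DSRInstance.k-positive I) (m≤m+n _ _)
  ; Yes       = λ I → let open DSRInstance I in Reachable G k Ds Dt
  }

module Submission where

-- Call u closed to v if u = v or u ~ v.  Process the vertices one by one,
-- keeping a vertex in a list C, the core, only if some (k+1)-tuple of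
-- vertices hits (the closed neighbourhoods of) all of C but not the new
-- vertex; in the end a tuple of at most k+1 vertices hitting C dominates G.
-- The core is small: if S is a set of common closed neighbours of a list C
-- of kept vertices, the tuple that misses the last vertex v of C avoids S,
-- so each of its k+1 entries is one more common closed neighbour of those
-- earlier elements of C that it hits, and with d common closed neighbours
-- a list of more than 2d vertices would contain a K_{d,d}.
--
-- A path in the reconfiguration graph amounts to a sequence of dominating
-- k-tuples, possibly with repetitions, each obtained from the entries of the
-- preceding one and one further vertex: unused tokens can wait anywhere.
-- Such a sequence depends only on the traces of the vertices on the core,
-- that is, on which core vertices they hit, and there are boundedly many
-- traces, so exhaustive search decides the question.
--
-- Programs are written in a small first-order language of lists and folds,
-- compiled to WHILE.  Only the loops over vertices need a running time
-- analysis: a term applied to values of bounded size takes at most its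
-- maximal time over the finitely many such values, whatever it does.


open import Defs
open import Data.Bool using (Bool; _∧_; _∨_; false; if_then_else_; not; true)
open import Data.Bool.ListAction using (all; any)
open import Data.Bool.Properties using (∨-assoc; ∨-identityʳ)
open import Data.Empty using (⊥; ⊥-elim)
open import Data.Fin using (Fin; inject≤; splitAt; suc; zero)
  renaming (_≟_ to _≟ᶠ_)
open import Data.Fin.Properties using (inject≤-injective; splitAt⁻¹-↑ʳ; splitAt⁻¹-↑ˡ)
open import Data.Fin.Subset using (Subset; ∣_∣)
  renaming (_∈_ to _∈ˢ_; _⊆_ to _⊆ˢ_)
open import Data.Fin.Subset.Properties using (p⊂q⇒∣p∣<∣q∣; ⊆-antisym)
  renaming (_∈?_ to _∈ˢ?_)
open import Data.List
  using (List; []; _++_; _∷_; allFin; cartesianProduct; cartesianProductWith; filterᵇ; foldl;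
         foldr; length; lookup; map; replicate; reverse; tabulate; upTo; zip)
open import Data.List.Membership.Propositional using (_∈_; _∉_; find)
open import Data.List.Membership.Propositional.Properties
  using (∈-++⁺ʳ; ∈-++⁺ˡ; ∈-++⁻; ∈-allFin; ∈-cartesianProductWith⁺; ∈-cartesianProductWith⁻;
         ∈-cartesianProduct⁺; ∈-lookup; ∈-map⁺; ∈-map⁻; ∈-upTo⁺; ∈-∃++)
open import Data.List.Properties
  using (++-assoc; foldl-cong; foldr-cong; length-++; length-map; length-replicate;
         length-reverse; length-tabulate; length-zipWith; map-++; map-cong; map-is-foldr;
         map-tabulate; map-∘; reverse-foldl; reverse-involutive; tabulate-cong; ∷-injective)
open import Data.List.Relation.Unary.All as All using (All; []; _∷_)
open import Data.List.Relation.Unary.All.Properties using (¬All⇒Any¬; ¬Any⇒All¬)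
open import Data.List.Relation.Unary.Any using (here; there)
open import Data.List.Relation.Unary.Any.Properties using (reverse⁻)
open import Data.List.Relation.Unary.Unique.Propositional using (Unique; []; _∷_)
open import Data.List.Relation.Unary.Unique.Propositional.Properties using (allFin⁺)
open import Data.Nat
  using (>-nonZero; NonZero; _*_; _+_; _<_; _^_; _≟_; _≤?_; _≤_; suc; s≤s; zero; z≤n; ℕ)
open import Data.Nat.ListAction using (sum)
open import Data.Nat.Properties
  using (*-identityʳ; *-mono-≤; *-monoʳ-≤; *-monoˡ-≤; +-cancelˡ-≤; +-comm; +-identityʳ; +-mono-≤;
         +-monoʳ-≤; +-monoˡ-≤; +-suc; <-irrefl; <-≤-trans; <⇒≤; >⇒≢; [m*n]*[o*p]≡[m*o]*[n*p];
         ^-monoʳ-≤; m^n>0; module ≤-Reasoning; m≤m*n; m≤m+n; m≤n*m; m≤n+m; m⊓n≤m; n<1+n; n≤1+n;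
         suc-injective; ≤-refl; ≤-reflexive; ≤-trans; ≰⇒>)
open import Data.Nat.Tactic.RingSolver using (solve-∀)
open import Data.Product using (_,_; _×_; proj₁; proj₂; ∃-syntax)
open import Data.Sum using (_⊎_; inj₁; inj₂)
open import Data.Unit using (tt; ⊤)
open import Data.Vec as Vec using ([]; _[_]≔_; _∷_)
open import Data.Vec.Properties
  using ([]=⇒lookup; []≔-idempotent; []≔-lookup; lookup⇒[]=; lookup∘update; lookup∘update′)
open import Function using (_∘_; flip; id)
open import Relation.Binary.Construct.Closure.ReflexiveTransitive using (Star; _◅_; _◅◅_; gmap; ε)
open import Relation.Binary.PropositionalEquality
  using (_≡_; _≢_; cong; cong₂; refl; subst; subst₂; sym; trans)
open import Relation.Nullary using (does; no; yes; ¬_)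
open import Relation.Nullary.Decidable using (dec-false; dec-true)
open import Relation.Nullary.Reflects using (Reflects; ofʸ; ofⁿ)

-- A first-order language and its compiler

-- Tuples of vertices would lead to n^k states, so the program neither names a vertex nor stores the
-- core. Its main loop carries a list with one trace per vertex of the graph, in the order of the
-- vertices; keeping a new vertex prepends one bit to every trace, taken from the row of that vertex
-- in the closed adjacency matrix. This list is long, but has few distinct entries, and every
-- expensive subprogram is run on lists of traces without duplicates or on tuples of k traces.
--
-- For the time bound, let X be a function of the parameter times the size of the input. A
-- subprogram applied to bounded values is charged X as a whole, a loop over vertices costs a power
-- of X, and the total exponent is read off the syntax of the program. A single power of X then
-- splits into the arbitrary function of the parameter and the polynomial in the size.

infixr 6 _⊗_

data Ty : Set where
  bool : Ty
  list : Ty → Ty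
  _⊗_  : Ty → Ty → Ty

Val : Ty → Set
Val bool     = Bool
Val (list τ) = List (Val τ)
Val (σ ⊗ τ)  = Val σ × Val τ

enc : ∀ τ → Val τ → Tree
enc bool     b       = encodeBool b
enc (list τ) xs      = encodeList (enc τ) xs
enc (σ ⊗ τ)  (x , y) = enc σ x ∙ enc τ y

Context : Set
Context = List Ty

Env : Context → Set
Env = All Val

-- Terms have no λ-abstraction.  app runs a term on variables of the
-- current context, and wk skips the second variable; both are mere
-- renamings and cost no time.
data Tm : Context → Ty → Set where
  var    : ∀ {Γ τ} → τ ∈ Γ → Tm Γ τ
  bit    : ∀ {Γ} → Bool → Tm Γ bool
  ite    : ∀ {Γ τ} → Tm Γ bool → Tm Γ τ → Tm Γ τ → Tm Γ τ
  empty  : ∀ {Γ τ} → Tm Γ (list τ)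
  _▹_    : ∀ {Γ τ} → Tm Γ τ → Tm Γ (list τ) → Tm Γ (list τ)
  uncons : ∀ {Γ σ τ} → Tm Γ (list σ) → Tm Γ τ → Tm (σ ∷ list σ ∷ Γ) τ → Tm Γ τ
  pair   : ∀ {Γ σ τ} → Tm Γ σ → Tm Γ τ → Tm Γ (σ ⊗ τ)
  fst    : ∀ {Γ σ τ} → Tm Γ (σ ⊗ τ) → Tm Γ σ
  snd    : ∀ {Γ σ τ} → Tm Γ (σ ⊗ τ) → Tm Γ τ
  bind   : ∀ {Γ σ τ} → Tm Γ σ → Tm (σ ∷ Γ) τ → Tm Γ τ
  fold   : ∀ {Γ σ τ} → Tm Γ (list σ) → Tm Γ τ → Tm (σ ∷ τ ∷ Γ) τ → Tm Γ τ
  app    : ∀ {Γ Θ τ} → Tm Θ τ → All (_∈ Γ) Θ → Tm Γ τ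
  wk     : ∀ {Γ ρ σ τ} → Tm (σ ∷ Γ) τ → Tm (σ ∷ ρ ∷ Γ) τ

infixr 5 _▹_

rename : ∀ {Γ Θ : Context} {P : Ty → Set} → All P Γ → All (_∈ Γ) Θ → All P Θ
rename ρ xs = All.map (All.lookup ρ) xs

⟦_⟧ : ∀ {Γ τ} → Tm Γ τ → Env Γ → Val τ
⟦ var x ⟧        ρ = All.lookup ρ x
⟦ bit b ⟧        ρ = b
⟦ ite c e f ⟧    ρ = if ⟦ c ⟧ ρ then ⟦ e ⟧ ρ else ⟦ f ⟧ ρ
⟦ empty ⟧        ρ = []
⟦ e ▹ f ⟧        ρ = ⟦ e ⟧ ρ ∷ ⟦ f ⟧ ρ
⟦ uncons e f g ⟧ ρ with ⟦ e ⟧ ρ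
... | []     = ⟦ f ⟧ ρ
... | x ∷ xs = ⟦ g ⟧ (x ∷ xs ∷ ρ)
⟦ pair e f ⟧     ρ = ⟦ e ⟧ ρ , ⟦ f ⟧ ρ
⟦ fst e ⟧        ρ = proj₁ (⟦ e ⟧ ρ)
⟦ snd e ⟧        ρ = proj₂ (⟦ e ⟧ ρ)
⟦ bind e f ⟧     ρ = ⟦ f ⟧ (⟦ e ⟧ ρ ∷ ρ)
⟦ fold e f g ⟧   ρ = foldl (λ a x → ⟦ g ⟧ (x ∷ a ∷ ρ)) (⟦ f ⟧ ρ) (⟦ e ⟧ ρ)
⟦ app e xs ⟧     ρ = ⟦ e ⟧ (rename ρ xs)
⟦ wk e ⟧ (x ∷ _ ∷ ρ) = ⟦ e ⟧ (x ∷ ρ)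

-- The constants here and in `time` are exact costs of the compiled commands: 2 for testing or
-- copying a variable, 3 for an assignment of `hd` or `tl`, 4 for building a cell. Exactness keeps
-- estimates of time out of the correctness proof of the compiler.
loopTime : ∀ {A B : Set} → (B → A → ℕ) → (B → A → B) → B → List A → ℕ
loopTime t f a []       = 2
loopTime t f a (x ∷ xs) = suc (1 + ((3 + (3 + (t a x + 2))) + loopTime t f (f a x) xs))

time : ∀ {Γ τ} → Tm Γ τ → Env Γ → ℕ
time (var x)        ρ = 2
time (bit true)     ρ = 4
time (bit false)    ρ = 2
time (ite c e f)    ρ = time c ρ + suc (1 + (if ⟦ c ⟧ ρ then time e ρ else time f ρ))
time empty          ρ = 2
time (e ▹ f)        ρ = time e ρ + (time f ρ + 4)
time (uncons e f g) ρ with ⟦ e ⟧ ρ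
... | []     = time e ρ + suc (1 + time f ρ)
... | x ∷ xs = time e ρ + suc (1 + (3 + (3 + (time g (x ∷ xs ∷ ρ) + 2))))
time (pair e f)     ρ = time e ρ + (time f ρ + 4)
time (fst e)        ρ = time e ρ + 3
time (snd e)        ρ = time e ρ + 3
time (bind e f)     ρ = time e ρ + (time f (⟦ e ⟧ ρ ∷ ρ) + 2)
time (fold e f g)   ρ = time e ρ + (time f ρ +
  (loopTime (λ a x → time g (x ∷ a ∷ ρ)) (λ a x → ⟦ g ⟧ (x ∷ a ∷ ρ)) (⟦ f ⟧ ρ) (⟦ e ⟧ ρ) + 2))
time (app e xs)     ρ = time e (rename ρ xs)
time (wk e) (x ∷ _ ∷ ρ) = time e (x ∷ ρ)

Locations : Context → Set
Locations = All (λ _ → ℕ)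

-- compile e ls b reads the variables of e from the locations ls, which
-- lie below b, leaves everything below b alone, and puts the value in b.
compile : ∀ {Γ τ} → Tm Γ τ → Locations Γ → ℕ → Command
loopBody : ∀ {Γ σ τ} → Tm (σ ∷ τ ∷ Γ) τ → Locations Γ → ℕ → Command

loopBody g ls b =
  (2 + b) ≔ hd (var b) ⨾ b ≔ tl (var b) ⨾
  compile g (2 + b ∷ 1 + b ∷ ls) (3 + b) ⨾ suc b ≔ var (3 + b)

compile (var x)        ls b = b ≔ var (All.lookup ls x)
compile (bit true)     ls b = b ≔ cons nil nil
compile (bit false)    ls b = b ≔ nil
compile (ite c e f)    ls b = compile c ls b ⨾ ite (var b) (compile e ls b) (compile f ls b)
compile empty          ls b = b ≔ nil
compile (e ▹ f)        ls b = compile e ls b ⨾ compile f ls (1 + b) ⨾ b ≔ cons (var b) (var (1 + b))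
compile (uncons e f g) ls b =
  compile e ls b ⨾
  ite (var b)
      (suc b ≔ hd (var b) ⨾ b ≔ tl (var b) ⨾ compile g (1 + b ∷ b ∷ ls) (2 + b) ⨾ b ≔ var (2 + b))
      (compile f ls b)
compile (pair e f)     ls b = compile e ls b ⨾ compile f ls (1 + b) ⨾ b ≔ cons (var b) (var (1 + b))
compile (fst e)        ls b = compile e ls b ⨾ b ≔ hd (var b)
compile (snd e)        ls b = compile e ls b ⨾ b ≔ tl (var b)
compile (bind e f)     ls b = compile e ls b ⨾ compile f (b ∷ ls) (1 + b) ⨾ b ≔ var (1 + b)
compile (fold e f g)   ls b =
  compile e ls b ⨾ compile f ls (1 + b) ⨾ while (var b) (loopBody g ls b) ⨾ b ≔ var (1 + b)
compile (app e xs)     ls b = compile e (rename ls xs) b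
compile (wk e) (l ∷ _ ∷ ls) b = compile e (l ∷ ls) b

-- Correctness and exact running time of compiled programs

update-same : ∀ (σ : Store) x t → (σ [ x ↦ t ]) x ≡ t
update-same σ x t rewrite dec-true (x ≟ x) refl = refl

update-other : ∀ (σ : Store) {x y} t → x ≢ y → (σ [ x ↦ t ]) y ≡ σ y
update-other σ {x} {y} t x≢y rewrite dec-false (x ≟ y) x≢y = refl

data Stored (b : ℕ) (σ : Store) : ∀ {Γ} → Env Γ → Locations Γ → Set where
  []  : Stored b σ [] []
  _∷_ : ∀ {τ Γ l v} {ρ : Env Γ} {ls} →
        l < b × σ l ≡ enc τ v → Stored b σ ρ ls → Stored b σ {τ ∷ Γ} (v ∷ ρ) (l ∷ ls)

_≈[_]_ : Store → ℕ → Store → Set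
σ ≈[ b ] τ = ∀ {y} → y < b → σ y ≡ τ y

stored-lookup : ∀ {b σ Γ τ} {ρ : Env Γ} {ls} → Stored b σ ρ ls → (x : τ ∈ Γ) →
                All.lookup ls x < b × σ (All.lookup ls x) ≡ enc τ (All.lookup ρ x)
stored-lookup (p ∷ ps) (here refl) = p
stored-lookup (p ∷ ps) (there x)   = stored-lookup ps x

stored-rename : ∀ {b σ Γ Θ} {ρ : Env Γ} {ls} → Stored b σ ρ ls → (xs : All (_∈ Γ) Θ) →
                Stored b σ (rename ρ xs) (rename ls xs)
stored-rename ps []       = []
stored-rename ps (x ∷ xs) = stored-lookup ps x ∷ stored-rename ps xs

stored-mono : ∀ {b c σ τ Γ} {ρ : Env Γ} {ls} → b ≤ c → τ ≈[ b ] σ →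
              Stored b σ ρ ls → Stored c τ ρ ls
stored-mono b≤c τ≈σ []               = []
stored-mono b≤c τ≈σ ((l<b , eq) ∷ ps) =
  (<-≤-trans l<b b≤c , trans (τ≈σ l<b) eq) ∷ stored-mono b≤c τ≈σ ps

-- A Hoare triple with exact time and a frame condition. Locations are used as a stack, so
-- protecting everything below `b` keeps the environment and earlier intermediate values alive while
-- further subterms are evaluated.
record Runs (c : Command) (σ : Store) (t b : ℕ) (Post : Store → Set) : Set where
  constructor runs
  field
    {final} : Store
    run     : ⟨ c , σ ⟩⇓ final in-time t
    frame   : final ≈[ b ] σ
    post    : Post final

Computes : Command → Store → ℕ → ℕ → Tree → Set
Computes c σ t b v = Runs c σ t b (λ τ → τ b ≡ v)

infixr 4 _then_

_then_ : ∀ {c d σ s t b P Q} → Runs c σ s b P →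
         (∀ {τ} → τ ≈[ b ] σ → P τ → Runs d τ t b Q) → Runs (c ⨾ d) σ (s + t) b Q
runs r₁ f₁ p₁ then k with k f₁ p₁
... | runs r₂ f₂ p₂ = runs (seq r₁ r₂) (λ y<b → trans (f₂ y<b) (f₁ y<b)) p₂

-- The implication may use that all locations below `a`, not only those below `b`, were preserved.
-- This is how a value already placed in `b` survives a computation that starts at `1 + b`.
narrow : ∀ {c σ t a b P Q} → b ≤ a → (∀ {τ} → τ ≈[ a ] σ → P τ → Q τ) →
         Runs c σ t a P → Runs c σ t b Q
narrow b≤a imp (runs r f p) = runs r (λ y<b → f (<-≤-trans y<b b≤a)) (imp f p)

assigns : ∀ {b a σ e} → b ≤ a →
          Runs (a ≔ e) σ (suc (cost e)) b (λ τ → τ a ≡ eval e σ × (∀ {y} → a ≢ y → τ y ≡ σ y))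
assigns {σ = σ} b≤a =
  runs assign (λ y<b → update-other σ _ (>⇒≢ (<-≤-trans y<b b≤a)))
    (update-same σ _ _ , update-other σ _)

computes-assign : ∀ {b σ e v} → eval e σ ≡ v → Computes (b ≔ e) σ (suc (cost e)) b v
computes-assign eq = narrow ≤-refl (λ { _ (p , _) → trans p eq }) (assigns ≤-refl)

nonnil : ∀ {s t} → s ∙ t ≢ nil
nonnil ()

1+m≢m : ∀ {m : ℕ} → suc m ≢ m
1+m≢m ()

runs-true : ∀ {c d σ t b a P u v} → σ a ≡ u ∙ v →
            Runs c σ t b P → Runs (ite (var a) c d) σ (suc (1 + t)) b P
runs-true eq (runs r f p) = runs (if-true (λ eq' → nonnil (trans (sym eq) eq')) r) f p

runs-false : ∀ {c d σ t b a P} → σ a ≡ nil →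
             Runs d σ t b P → Runs (ite (var a) c d) σ (suc (1 + t)) b P
runs-false eq (runs r f p) = runs (if-false eq r) f p

runs-while : ∀ {c σ s t b a P Q u v} → σ a ≡ u ∙ v → Runs c σ s b P →
             (∀ {τ} → τ ≈[ b ] σ → P τ → Runs (while (var a) c) τ t b Q) →
             Runs (while (var a) c) σ (suc (1 + (s + t))) b Q
runs-while eq (runs r₁ f₁ p₁) k with k f₁ p₁
... | runs r₂ f₂ p₂ = runs (while-true (λ eq' → nonnil (trans (sym eq) eq')) r₁ r₂)
                           (λ y<b → trans (f₂ y<b) (f₁ y<b)) p₂

compile-correct : ∀ {Γ τ} (e : Tm Γ τ) {ρ ls b σ} → Stored b σ ρ ls →
                  Computes (compile e ls b) σ (time e ρ) b (enc τ (⟦ e ⟧ ρ))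

computes-cons : ∀ {Γ τ υ} (e : Tm Γ τ) (f : Tm Γ υ) {ρ ls b σ} → Stored b σ ρ ls →
                Computes (compile e ls b ⨾ compile f ls (1 + b) ⨾ b ≔ cons (var b) (var (1 + b))) σ
                  (time e ρ + (time f ρ + 4)) b (enc τ (⟦ e ⟧ ρ) ∙ enc υ (⟦ f ⟧ ρ))

-- Induction on the part of the list still to be read, which the loop keeps in `b`, with the
-- accumulator in `1 + b`; each round restores this layout for the next.
loop-correct : ∀ {Γ σ τ} (g : Tm (σ ∷ τ ∷ Γ) τ) {ρ ls b μ} (xs : List (Val σ)) (a : Val τ) →
  Stored b μ ρ ls → μ b ≡ enc (list σ) xs → μ (1 + b) ≡ enc τ a →
  Runs (while (var b) (loopBody g ls b)) μ
       (loopTime (λ a x → time g (x ∷ a ∷ ρ)) (λ a x → ⟦ g ⟧ (x ∷ a ∷ ρ)) a xs) b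
       (λ υ → υ (1 + b) ≡ enc τ (foldl (λ a x → ⟦ g ⟧ (x ∷ a ∷ ρ)) a xs))

compile-correct (var x)        S = computes-assign (proj₂ (stored-lookup S x))
compile-correct (bit true)     S = computes-assign refl
compile-correct (bit false)    S = computes-assign refl
compile-correct empty          S = computes-assign refl
compile-correct (ite c e f) {ρ} S with ⟦ c ⟧ ρ | compile-correct c S
... | true  | C = C then λ fr eq →
  runs-true eq (compile-correct e (stored-mono ≤-refl fr S))
... | false | C = C then λ fr eq →
  runs-false eq (compile-correct f (stored-mono ≤-refl fr S))
compile-correct (e ▹ f)        S = computes-cons e f S
compile-correct (pair e f)     S = computes-cons e f S
compile-correct (fst e)        S =
  compile-correct e S then λ _ eq → computes-assign (cong head eq)
compile-correct (snd e)        S =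
  compile-correct e S then λ _ eq → computes-assign (cong tail eq)
compile-correct (bind e f)     S =
  compile-correct e S then λ fr eq →
  narrow (n≤1+n _) (λ _ p → p)
    (compile-correct f ((n<1+n _ , eq) ∷ stored-mono (n≤1+n _) fr S)) then λ _ eq' →
  computes-assign eq'
compile-correct (uncons {σ = σ} e f g) {ρ} {b = b} S with ⟦ e ⟧ ρ | compile-correct e S
... | []     | C = C then λ fr eq →
  runs-false eq (compile-correct f (stored-mono ≤-refl fr S))
... | x ∷ xs | C = C then λ {μ} fr eq →
  runs-true eq (
        assigns (n≤1+n _) then λ {μ₁} fr₁ (eq₁ , same₁) →
        assigns ≤-refl then λ {μ₂} fr₂ (eq₂ , same₂) →
        narrow (m≤n+m b 2) (λ _ p → p)
          (compile-correct g {ls = 1 + b ∷ b ∷ _}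
             ((n<1+n _ , trans (same₂ (λ ())) (trans eq₁ (cong head eq))) ∷
              (m≤n+m _ 1 , trans eq₂ (cong tail (trans (same₁ 1+m≢m) eq))) ∷
              stored-mono (m≤n+m b 2)
                (λ y<b → trans (fr₂ y<b) (trans (fr₁ y<b) (fr y<b))) S)) then λ _ eq₃ →
        computes-assign eq₃)
compile-correct (fold e f g) {ρ} {b = b} S =
  compile-correct e S then λ fr eq →
  narrow (n≤1+n _) (λ fr' p → trans (fr' ≤-refl) eq , p)
    (compile-correct f (stored-mono (n≤1+n _) fr S)) then λ fr' (eq₁ , eq₂) →
  loop-correct g (⟦ e ⟧ ρ) (⟦ f ⟧ ρ) (stored-mono ≤-refl (λ y<b → trans (fr' y<b) (fr y<b)) S) eq₁ eq₂
    then λ _ eq₃ →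
  computes-assign eq₃
compile-correct (app e xs)     S = compile-correct e (stored-rename S xs)
compile-correct (wk e) (p ∷ _ ∷ S) = compile-correct e (p ∷ S)

computes-cons e f S =
  compile-correct e S then λ fr eq →
  narrow (n≤1+n _) (λ fr' p → trans (fr' ≤-refl) eq , p)
    (compile-correct f (stored-mono (n≤1+n _) fr S)) then λ _ (eq₁ , eq₂) →
  computes-assign (cong₂ _∙_ eq₁ eq₂)

loop-correct g [] a S eq eq' = runs (while-false eq) (λ _ → refl) eq'
loop-correct g {ρ} {ls} {b} (x ∷ xs) a S eq eq' =
  runs-while eq (
        assigns (m≤n+m b 2) then λ fr₁ (eq₁ , same₁) →
        assigns ≤-refl then λ fr₂ (eq₂ , same₂) →
        narrow (m≤n+m b 3)
          (λ fr₃ p → trans (fr₃ (m≤n+m _ 2)) (trans eq₂ (cong tail (trans (same₁ (λ ())) eq))) , p)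
          (compile-correct g {ls = 2 + b ∷ 1 + b ∷ ls}
             ((n<1+n _ , trans (same₂ (λ ())) (trans eq₁ (cong head eq))) ∷
              (m≤n+m _ 1 , trans (same₂ (λ ())) (trans (same₁ 1+m≢m) eq')) ∷
              stored-mono (m≤n+m b 3) (λ y<b → trans (fr₂ y<b) (fr₁ y<b)) S)) then
        λ fr₄ (eq₄ , eq₅) →
        narrow ≤-refl (λ { _ (p , q) → trans (q 1+m≢m) eq₄ , trans p eq₅ }) (assigns (n≤1+n b)))
  λ fr (p , q) → loop-correct g xs (⟦ g ⟧ (x ∷ a ∷ ρ)) (stored-mono ≤-refl fr S) p q

-- Running time

SmallLoop : ∀ {A B : Set} → (B → A → Set) → (B → A → B) → B → List A → Set
SmallLoop P f a []       = ⊤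
SmallLoop P f a (x ∷ xs) = P a x × SmallLoop P f (f a x) xs

-- All loops run at most X times, except inside applications which take
-- at most X steps anyway.
data Small (X : ℕ) : ∀ {Γ τ} → Tm Γ τ → Env Γ → Set where
  small-var    : ∀ {Γ τ ρ} {x : τ ∈ Γ} → Small X (var x) ρ
  small-bit    : ∀ {Γ b} {ρ : Env Γ} → Small X (bit b) ρ
  small-ite    : ∀ {Γ τ ρ c} {e f : Tm Γ τ} →
                 Small X c ρ → Small X e ρ → Small X f ρ → Small X (ite c e f) ρ
  small-empty  : ∀ {Γ τ} {ρ : Env Γ} → Small X (empty {τ = τ}) ρ
  small-▹      : ∀ {Γ τ ρ} {e : Tm Γ τ} {f} → Small X e ρ → Small X f ρ → Small X (e ▹ f) ρ
  small-uncons : ∀ {Γ σ τ ρ} {e : Tm Γ (list σ)} {f : Tm Γ τ} {g} → Small X e ρ → Small X f ρ →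
                 (∀ {x xs} → ⟦ e ⟧ ρ ≡ x ∷ xs → Small X g (x ∷ xs ∷ ρ)) → Small X (uncons e f g) ρ
  small-pair   : ∀ {Γ σ τ ρ} {e : Tm Γ σ} {f : Tm Γ τ} →
                 Small X e ρ → Small X f ρ → Small X (pair e f) ρ
  small-fst    : ∀ {Γ σ τ ρ} {e : Tm Γ (σ ⊗ τ)} → Small X e ρ → Small X (fst e) ρ
  small-snd    : ∀ {Γ σ τ ρ} {e : Tm Γ (σ ⊗ τ)} → Small X e ρ → Small X (snd e) ρ
  -- The value of `e` is given up to an equation, so a specification of `e` can replace its unfolded
  -- meaning in the derivation for `f`.
  small-bind   : ∀ {Γ σ τ ρ v} {e : Tm Γ σ} {f : Tm (σ ∷ Γ) τ} →
                 Small X e ρ → ⟦ e ⟧ ρ ≡ v → Small X f (v ∷ ρ) → Small X (bind e f) ρ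
  small-fold   : ∀ {Γ σ τ ρ} {e : Tm Γ (list σ)} {f : Tm Γ τ} {g} →
                 Small X e ρ → Small X f ρ → length (⟦ e ⟧ ρ) ≤ X →
                 SmallLoop (λ a x → Small X g (x ∷ a ∷ ρ)) (λ a x → ⟦ g ⟧ (x ∷ a ∷ ρ)) (⟦ f ⟧ ρ)
                     (⟦ e ⟧ ρ) →
                 Small X (fold e f g) ρ
  small-app    : ∀ {Γ Θ τ ρ} {e : Tm Θ τ} {xs : All (_∈ Γ) Θ} →
                 Small X e (rename ρ xs) → Small X (app e xs) ρ
  small-time   : ∀ {Γ Θ τ ρ} {e : Tm Θ τ} {xs : All (_∈ Γ) Θ} →
                 time e (rename ρ xs) ≤ X → Small X (app e xs) ρ
  small-wk     : ∀ {Γ ρ σ τ x y} {e : Tm (σ ∷ Γ) τ} {ξ : Env Γ} →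
                 Small X e (x ∷ ξ) → Small X (wk {ρ = ρ} e) (x ∷ y ∷ ξ)

loopFree : ∀ {Γ τ} → Tm Γ τ → Bool
loopFree (var x)        = true
loopFree (bit b)        = true
loopFree (ite c e f)    = loopFree c ∧ loopFree e ∧ loopFree f
loopFree empty          = true
loopFree (e ▹ f)        = loopFree e ∧ loopFree f
loopFree (uncons e f g) = loopFree e ∧ loopFree f ∧ loopFree g
loopFree (pair e f)     = loopFree e ∧ loopFree f
loopFree (fst e)        = loopFree e
loopFree (snd e)        = loopFree e
loopFree (bind e f)     = loopFree e ∧ loopFree f
loopFree (fold e f g)   = false
loopFree (app e xs)     = false
loopFree (wk e)         = loopFree e

small-loopFree : ∀ {X Γ τ} (e : Tm Γ τ) {ρ} → loopFree e ≡ true → Small X e ρ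
small-loopFree (var x) eq = small-var
small-loopFree (bit b) eq = small-bit
small-loopFree (ite c e f) eq with loopFree c in c≡ | loopFree e in e≡ | loopFree f in f≡ | eq
... | true | true | true | _ = small-ite (small-loopFree c c≡) (small-loopFree e e≡)
    (small-loopFree f f≡)
small-loopFree empty eq = small-empty
small-loopFree (e ▹ f) eq with loopFree e in e≡ | loopFree f in f≡ | eq
... | true | true | _ = small-▹ (small-loopFree e e≡) (small-loopFree f f≡)
small-loopFree (uncons e f g) eq with loopFree e in e≡ | loopFree f in f≡ | loopFree g in g≡ | eq
... | true | true | true | _ = small-uncons (small-loopFree e e≡) (small-loopFree f f≡)
    (λ _ → small-loopFree g g≡)
small-loopFree (pair e f) eq with loopFree e in e≡ | loopFree f in f≡ | eq
... | true | true | _ = small-pair (small-loopFree e e≡) (small-loopFree f f≡)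
small-loopFree (fst e) eq = small-fst (small-loopFree e eq)
small-loopFree (snd e) eq = small-snd (small-loopFree e eq)
small-loopFree (bind e f) eq with loopFree e in e≡ | loopFree f in f≡ | eq
... | true | true | _ = small-bind (small-loopFree e e≡) refl (small-loopFree f f≡)
small-loopFree (wk e) {x ∷ _ ∷ ρ} eq = small-wk (small-loopFree e eq)

-- The exponent of `X` in the running time. Adding the times of two subterms costs one factor `X`; a
-- loop costs two, one for the number of rounds and one for the constants.
degree : ∀ {Γ τ} → Tm Γ τ → ℕ
degree (var x)        = 1
degree (bit b)        = 1
degree (ite c e f)    = suc (degree c + (degree e + degree f))
degree empty          = 1
degree (e ▹ f)        = suc (degree e + degree f)
degree (uncons e f g) = suc (degree e + (degree f + degree g))
degree (pair e f)     = suc (degree e + degree f)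
degree (fst e)        = suc (degree e + 0)
degree (snd e)        = suc (degree e + 0)
degree (bind e f)     = suc (degree e + degree f)
degree (fold e f g)   = suc (degree e + suc (degree f + (2 + degree g)))
degree (app e xs)     = suc (degree e)
degree (wk e)         = degree e

module _ (X : ℕ) (20≤X : 20 ≤ X) where

  private
    instance
      X-nonZero : NonZero X
      X-nonZero = >-nonZero (≤-trans (s≤s z≤n) 20≤X)

    1≤pow : ∀ i → 1 ≤ X ^ i
    1≤pow i = m^n>0 X i

    pow-mono : ∀ {i j} → i ≤ j → X ^ i ≤ X ^ j
    pow-mono = ^-monoʳ-≤ X

    const-pow : ∀ {k} i → k ≤ 20 → k ≤ X ^ suc i
    const-pow i k≤20 = ≤-trans k≤20 (≤-trans 20≤X (≤-trans
      (≤-reflexive (unit X)) (*-monoʳ-≤ X (1≤pow i))))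
      where unit : ∀ x → x ≡ x * 1
            unit = solve-∀

    -- Both summands and the constant are raised to the common power `Y`, with total coefficient 1 +
    -- 1 + 18 = 20, and one more factor `X` absorbs it. The requirement 20 ≤ X comes from here.
    sum-pow : ∀ {a b k} i j → k ≤ 18 → a ≤ X ^ i → b ≤ X ^ j → a + (b + k) ≤ X ^ suc (i + j)
    sum-pow {a} {b} {k} i j k≤ a≤ b≤ = begin
      a + (b + k)
        ≤⟨ +-mono-≤ (≤-trans a≤ (pow-mono (m≤m+n i j)))
           (+-mono-≤ (≤-trans b≤ (pow-mono (m≤n+m j i))) (≤-trans k≤ (*-monoʳ-≤ 18 (1≤pow (i + j))))) ⟩
      Y + (Y + 18 * Y)  ≡⟨ collect Y ⟩
      20 * Y            ≤⟨ *-monoˡ-≤ Y 20≤X ⟩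
      X * Y             ∎
      where
      open ≤-Reasoning
      Y = X ^ (i + j)
      collect : ∀ y → y + (y + 18 * y) ≡ 20 * y
      collect = solve-∀

    -- Beyond its body, a round costs 2 + 3 + 3 + 2 = 10 for the test, `hd`, `tl` and the copy of
    -- the accumulator; with the body this gives the coefficient 11. The final 2 is the failing
    -- test.
    loop-pow : ∀ {A B : Set} {t : B → A → ℕ} {f : B → A → B} {P : B → A → Set} j →
               (∀ a x → P a x → t a x ≤ X ^ j) → ∀ a xs → SmallLoop P f a xs →
               loopTime t f a xs ≤ length xs * (11 * X ^ j) + 2
    loop-pow j t≤ a []       S       = ≤-refl
    loop-pow {t = t} {f} j t≤ a (x ∷ xs) (s , S) = begin
      suc (1 + ((3 + (3 + (t a x + 2))) + loopTime t f (f a x) xs))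
        ≡⟨ shuffle (t a x) (loopTime t f (f a x) xs) ⟩
      t a x + 10 * 1 + loopTime t f (f a x) xs
        ≤⟨ +-mono-≤ (+-mono-≤ (t≤ a x s) (*-monoʳ-≤ 10 (1≤pow j))) (loop-pow j t≤ (f a x) xs S) ⟩
      Y + 10 * Y + (length xs * (11 * Y) + 2)  ≡⟨ collect Y (length xs) ⟩
      suc (length xs) * (11 * Y) + 2           ∎
      where
      open ≤-Reasoning
      Y = X ^ j
      shuffle : ∀ t r → suc (1 + ((3 + (3 + (t + 2))) + r)) ≡ t + 10 * 1 + r
      shuffle = solve-∀
      collect : ∀ y n → y + 10 * y + (n * (11 * y) + 2) ≡ suc n * (11 * y) + 2
      collect = solve-∀

    loop-pow′ : ∀ {A B : Set} {t : B → A → ℕ} {f : B → A → B} {P : B → A → Set} j →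
                (∀ a x → P a x → t a x ≤ X ^ j) → ∀ a xs → length xs ≤ X → SmallLoop P f a xs →
                loopTime t f a xs ≤ X ^ (2 + j)
    loop-pow′ {t = t} {f} j t≤ a xs len S = begin
      loopTime t f a xs                ≤⟨ loop-pow j t≤ a xs S ⟩
      length xs * (11 * Y) + 2         ≤⟨ +-mono-≤ (*-monoˡ-≤ (11 * Y) len)
          (*-monoʳ-≤ 2 (*-mono-≤ 1≤X (1≤pow j))) ⟩
      X * (11 * Y) + 2 * (X * Y)       ≡⟨ collect X Y ⟩
      13 * (X * Y)                     ≤⟨ *-monoˡ-≤ (X * Y) (≤-trans (m≤m+n 13 7) 20≤X) ⟩
      X * (X * Y)                      ∎
      where
      open ≤-Reasoning
      Y = X ^ j
      1≤X = ≤-trans (s≤s z≤n) 20≤X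
      collect : ∀ x y → x * (11 * y) + 2 * (x * y) ≡ 13 * (x * y)
      collect = solve-∀

  time-bound : ∀ {Γ τ} (e : Tm Γ τ) {ρ} → Small X e ρ → time e ρ ≤ X ^ degree e
  time-bound (var x)     small-var = const-pow 0 (m≤m+n 2 18)
  time-bound (bit true)  small-bit = const-pow 0 (m≤m+n 4 16)
  time-bound (bit false) small-bit = const-pow 0 (m≤m+n 2 18)
  time-bound empty       small-empty = const-pow 0 (m≤m+n 2 18)
  time-bound (ite c e f) {ρ} (small-ite Sc Se Sf) with ⟦ c ⟧ ρ
  ... | true  = ≤-trans (≤-reflexive (shift (time c ρ) (time e ρ)))
                  (sum-pow (degree c) _ (m≤m+n 2 16) (time-bound c Sc)
                    (≤-trans (time-bound e Se) (pow-mono (m≤m+n (degree e) (degree f)))))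
    where shift : ∀ a b → a + suc (1 + b) ≡ a + (b + 2)
          shift = solve-∀
  ... | false = ≤-trans (≤-reflexive (shift (time c ρ) (time f ρ)))
                  (sum-pow (degree c) _ (m≤m+n 2 16) (time-bound c Sc)
                    (≤-trans (time-bound f Sf) (pow-mono (m≤n+m (degree f) (degree e)))))
    where shift : ∀ a b → a + suc (1 + b) ≡ a + (b + 2)
          shift = solve-∀
  time-bound (e ▹ f) (small-▹ Se Sf) = sum-pow (degree e) _ (m≤m+n 4 14) (time-bound e Se)
      (time-bound f Sf)
  time-bound (uncons e f g) {ρ} (small-uncons Se Sf Sg) with ⟦ e ⟧ ρ
  ... | []     = ≤-trans (≤-reflexive (shift (time e ρ) (time f ρ)))
                  (sum-pow (degree e) _ (m≤m+n 2 16) (time-bound e Se)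
                    (≤-trans (time-bound f Sf) (pow-mono (m≤m+n (degree f) (degree g)))))
    where shift : ∀ a b → a + suc (1 + b) ≡ a + (b + 2)
          shift = solve-∀
  ... | x ∷ xs = ≤-trans (≤-reflexive (shift (time e ρ) (time g (x ∷ xs ∷ ρ))))
                  (sum-pow (degree e) _ (m≤m+n 10 8) (time-bound e Se)
                    (≤-trans (time-bound g (Sg refl)) (pow-mono (m≤n+m (degree g) (degree f)))))
    where shift : ∀ a b → a + suc (1 + (3 + (3 + (b + 2)))) ≡ a + (b + 10)
          shift = solve-∀
  time-bound (pair e f) (small-pair Se Sf) = sum-pow (degree e) _ (m≤m+n 4 14) (time-bound e Se)
      (time-bound f Sf)
  time-bound (fst e) (small-fst S) = sum-pow {b = 0} (degree e) 0 (m≤m+n 3 15) (time-bound e S) z≤n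
  time-bound (snd e) (small-snd S) = sum-pow {b = 0} (degree e) 0 (m≤m+n 3 15) (time-bound e S) z≤n
  time-bound (bind e f) (small-bind Se refl Sf) = sum-pow (degree e) _ (m≤m+n 2 16)
      (time-bound e Se) (time-bound f Sf)
  time-bound (fold e f g) {ρ} (small-fold Se Sf len Sg) =
    ≤-trans (+-monoʳ-≤ (time e ρ) (m≤m+n _ 0))
      (sum-pow (degree e) _ z≤n (time-bound e Se)
        (sum-pow (degree f) _ (m≤m+n 2 16) (time-bound f Sf)
          (loop-pow′ (degree g) (λ a x S → time-bound g S) (⟦ f ⟧ ρ) (⟦ e ⟧ ρ) len Sg)))
  time-bound (app e xs) (small-app S) = ≤-trans (time-bound e S) (pow-mono (n≤1+n (degree e)))
  time-bound (app e xs) (small-time t≤) = ≤-trans t≤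
      (≤-trans (≤-reflexive (unit X)) (*-monoʳ-≤ X (1≤pow (degree e))))
    where unit : ∀ x → x ≡ x * 1
          unit = solve-∀
  time-bound (wk e) (small-wk S) = time-bound e S

-- The loop rule: `I` is an invariant of the accumulator, and a step may use it together with the
-- origin of its element in the list.
small-loop : ∀ {A B : Set} {P : B → A → Set} {f : B → A → B} (I : B → Set) (xs : List A) →
             (∀ {a x} → x ∈ xs → I a → P a x × I (f a x)) → ∀ {a} → I a → SmallLoop P f a xs
small-loop I []       step i = tt
small-loop I (x ∷ xs) step i with step (here refl) i
... | p , i′ = p , small-loop I xs (λ x∈ → step (there x∈)) i′

-- Values of bounded size and worst-case times

Bounded : ℕ → ∀ τ → Val τ → Set
Bounded s bool     b       = ⊤
Bounded s (list τ) xs      = length xs ≤ s × All (Bounded s τ) xs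
Bounded s (σ ⊗ τ)  (x , y) = Bounded s σ x × Bounded s τ y

BoundedEnv : ℕ → ∀ {Γ} → Env Γ → Set
BoundedEnv s []            = ⊤
BoundedEnv s (_∷_ {τ} v ρ) = Bounded s τ v × BoundedEnv s ρ

listsUpTo : ∀ {A : Set} → List A → ℕ → List (List A)
listsUpTo as zero    = [] ∷ []
listsUpTo as (suc m) = [] ∷ cartesianProductWith _∷_ as (listsUpTo as m)

values : ℕ → ∀ τ → List (Val τ)
values s bool     = true ∷ false ∷ []
values s (list τ) = listsUpTo (values s τ) s
values s (σ ⊗ τ)  = cartesianProduct (values s σ) (values s τ)

environments : ℕ → ∀ Γ → List (Env Γ)
environments s []      = [] ∷ []
environments s (τ ∷ Γ) = cartesianProductWith _∷_ (values s τ) (environments s Γ)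

-- Running times of terms without any loop discipline are controlled by
-- the finiteness of the set of bounded environments alone.
worstTime : ∀ {Γ τ} → Tm Γ τ → ℕ → ℕ
worstTime {Γ} e s = sum (map (time e) (environments s Γ))

∈-listsUpTo : ∀ {A : Set} {as : List A} {xs m} → length xs ≤ m → All (_∈ as) xs → xs ∈ listsUpTo as m
∈-listsUpTo {m = zero}  z≤n       []       = here refl
∈-listsUpTo {m = suc m} z≤n       []       = here refl
∈-listsUpTo             (s≤s len) (p ∷ ps) = there (∈-cartesianProductWith⁺ _∷_ p (∈-listsUpTo len ps))

∈-values : ∀ {s} τ {v} → Bounded s τ v → v ∈ values s τ
∈-values bool     {true}  b = here refl
∈-values bool     {false} b = there (here refl)
∈-values (list τ) (len , bs) = ∈-listsUpTo len (All.map (∈-values τ) bs)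
∈-values (σ ⊗ τ)  (b , c)    = ∈-cartesianProduct⁺ (∈-values σ b) (∈-values τ c)

∈-environments : ∀ {s Γ} {ρ : Env Γ} → BoundedEnv s ρ → ρ ∈ environments s Γ
∈-environments {ρ = []}    b        = here refl
∈-environments {ρ = _∷_ {τ} v ρ} (b , bs) = ∈-cartesianProductWith⁺ _∷_ (∈-values τ b)
    (∈-environments bs)

∈⇒≤sum : ∀ {n ns} → n ∈ ns → n ≤ sum ns
∈⇒≤sum (here refl) = m≤m+n _ _
∈⇒≤sum (there n∈)  = ≤-trans (∈⇒≤sum n∈) (m≤n+m _ _)

time≤worstTime : ∀ {Γ τ s} (e : Tm Γ τ) {ρ} → BoundedEnv s ρ → time e ρ ≤ worstTime e s
time≤worstTime e b = ∈⇒≤sum (∈-map⁺ (time e) (∈-environments b))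

-- Programs on lists of traces

v0 : ∀ {Γ a} → Tm (a ∷ Γ) a
v0 = var (here refl)

v1 : ∀ {Γ a b} → Tm (a ∷ b ∷ Γ) b
v1 = var (there (here refl))

v2 : ∀ {Γ a b c} → Tm (a ∷ b ∷ c ∷ Γ) c
v2 = var (there (there (here refl)))

v3 : ∀ {Γ a b c d} → Tm (a ∷ b ∷ c ∷ d ∷ Γ) d
v3 = var (there (there (there (here refl))))

pattern i0 = here refl
pattern i1 = there i0
pattern i2 = there i1
pattern i3 = there i2
pattern i4 = there i3
pattern i5 = there i4
pattern i6 = there i5

reverseT : ∀ {Γ σ} → Tm Γ (list σ) → Tm Γ (list σ)
reverseT e = fold e empty (v0 ▹ v1)

-- `fold` consumes its list from the left, so a right fold reverses the list first.
foldrT : ∀ {Γ σ τ} → Tm Γ (list σ) → Tm Γ τ → Tm (σ ∷ τ ∷ Γ) τ → Tm Γ τ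
foldrT e = fold (reverseT e)

mapT : ∀ {Γ σ τ} → Tm Γ (list σ) → Tm (σ ∷ Γ) τ → Tm Γ (list τ)
mapT e f = foldrT e empty (wk f ▹ v1)

filterT : ∀ {Γ σ} → Tm Γ (list σ) → Tm (σ ∷ Γ) bool → Tm Γ (list σ)
filterT e p = foldrT e empty (ite (wk p) (v0 ▹ v1) v1)

anyT allT : ∀ {Γ σ} → Tm Γ (list σ) → Tm (σ ∷ Γ) bool → Tm Γ bool
anyT e p = fold e (bit false) (ite (wk p) (bit true) v1)
allT e p = fold e (bit true) (ite (wk p) v1 (bit false))

productT : ∀ {Γ σ τ υ} → Tm Γ (list σ) → list τ ∈ Γ → Tm (τ ∷ σ ∷ []) υ → Tm Γ (list υ)
productT e y f =
  foldrT e empty (foldrT (var (there (there y))) v1 (app f (i0 ∷ i2 ∷ []) ▹ v1))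

-- The state of the fold is the output in reverse order together with the unread rest of the second
-- list.
zipT : ∀ {Γ σ τ} → Tm Γ (list σ) → Tm Γ (list τ) → Tm Γ (list (σ ⊗ τ))
zipT e f = reverseT (fst (fold e (pair empty f)
  (uncons (snd v1) v1 (pair (pair v2 v0 ▹ fst v3) v1))))

foldrT-correct : ∀ {Γ σ τ} (e : Tm Γ (list σ)) (z : Tm Γ τ) (g : Tm (σ ∷ τ ∷ Γ) τ) ρ →
  ⟦ foldrT e z g ⟧ ρ ≡ foldr (λ x a → ⟦ g ⟧ (x ∷ a ∷ ρ)) (⟦ z ⟧ ρ) (⟦ e ⟧ ρ)
foldrT-correct e z g ρ = reverse-foldl (λ a x → ⟦ g ⟧ (x ∷ a ∷ ρ)) (⟦ z ⟧ ρ) (⟦ e ⟧ ρ)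

mapT-correct : ∀ {Γ σ τ} (e : Tm Γ (list σ)) (f : Tm (σ ∷ Γ) τ) ρ →
  ⟦ mapT e f ⟧ ρ ≡ map (λ x → ⟦ f ⟧ (x ∷ ρ)) (⟦ e ⟧ ρ)
mapT-correct e f ρ = trans (foldrT-correct e empty (wk f ▹ v1) ρ) (sym (map-is-foldr (⟦ e ⟧ ρ)))

filterᵇ-is-foldr : ∀ {A : Set} (p : A → Bool) xs →
  foldr (λ x a → if p x then x ∷ a else a) [] xs ≡ filterᵇ p xs
filterᵇ-is-foldr p []       = refl
filterᵇ-is-foldr p (x ∷ xs) with p x
... | true  = cong (x ∷_) (filterᵇ-is-foldr p xs)
... | false = filterᵇ-is-foldr p xs

filterT-correct : ∀ {Γ σ} (e : Tm Γ (list σ)) (p : Tm (σ ∷ Γ) bool) ρ →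
  ⟦ filterT e p ⟧ ρ ≡ filterᵇ (λ x → ⟦ p ⟧ (x ∷ ρ)) (⟦ e ⟧ ρ)
filterT-correct e p ρ = trans (foldrT-correct e empty (ite (wk p) (v0 ▹ v1) v1) ρ)
    (filterᵇ-is-foldr _ (⟦ e ⟧ ρ))

foldl-any : ∀ {A : Set} (p : A → Bool) a xs →
  foldl (λ a x → if p x then true else a) a xs ≡ a ∨ any p xs
foldl-any p true  []       = refl
foldl-any p false []       = refl
foldl-any p a     (x ∷ xs) with p x
foldl-any p true  (x ∷ xs) | true  = foldl-any p true xs
foldl-any p false (x ∷ xs) | true  = foldl-any p true xs
foldl-any p a     (x ∷ xs) | false = foldl-any p a xs

foldl-all : ∀ {A : Set} (p : A → Bool) a xs →
  foldl (λ a x → if p x then a else false) a xs ≡ a ∧ all p xs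
foldl-all p true  []       = refl
foldl-all p false []       = refl
foldl-all p a     (x ∷ xs) with p x
foldl-all p a     (x ∷ xs) | true  = foldl-all p a xs
foldl-all p true  (x ∷ xs) | false = foldl-all p false xs
foldl-all p false (x ∷ xs) | false = foldl-all p false xs

anyT-correct : ∀ {Γ σ} (e : Tm Γ (list σ)) (p : Tm (σ ∷ Γ) bool) ρ →
  ⟦ anyT e p ⟧ ρ ≡ any (λ x → ⟦ p ⟧ (x ∷ ρ)) (⟦ e ⟧ ρ)
anyT-correct e p ρ = foldl-any _ false (⟦ e ⟧ ρ)

allT-correct : ∀ {Γ σ} (e : Tm Γ (list σ)) (p : Tm (σ ∷ Γ) bool) ρ →
  ⟦ allT e p ⟧ ρ ≡ all (λ x → ⟦ p ⟧ (x ∷ ρ)) (⟦ e ⟧ ρ)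
allT-correct e p ρ = foldl-all _ true (⟦ e ⟧ ρ)

productWith-is-foldr : ∀ {A B C : Set} (f : A → B → C) xs ys →
  foldr (λ x a → foldr (λ y b → f x y ∷ b) a ys) [] xs ≡ cartesianProductWith f xs ys
productWith-is-foldr f []       ys = refl
productWith-is-foldr f (x ∷ xs) ys = trans (append ys)
    (cong (map (f x) ys ++_) (productWith-is-foldr f xs ys))
  where
  append : ∀ {as} ys → foldr (λ y b → f x y ∷ b) as ys ≡ map (f x) ys ++ as
  append []       = refl
  append (y ∷ ys) = cong (f x y ∷_) (append ys)

productT-correct : ∀ {Γ σ τ υ} (e : Tm Γ (list σ)) (y : list τ ∈ Γ) (f : Tm (τ ∷ σ ∷ []) υ) ρ →
  ⟦ productT e y f ⟧ ρ ≡
  cartesianProductWith (λ x y → ⟦ f ⟧ (y ∷ x ∷ [])) (⟦ e ⟧ ρ) (All.lookup ρ y)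
productT-correct e y f ρ =
  trans (foldrT-correct e empty inner ρ)
  (trans (foldr-cong (λ x a → foldrT-correct (var (there (there y))) v1 body (x ∷ a ∷ ρ)) refl (⟦ e ⟧ ρ))
  (productWith-is-foldr _ (⟦ e ⟧ ρ) (All.lookup ρ y)))
  where
  body = app f (i0 ∷ i2 ∷ []) ▹ v1
  inner = foldrT (var (there (there y))) v1 body

zipT-correct : ∀ {Γ σ τ} (e : Tm Γ (list σ)) (f : Tm Γ (list τ)) ρ →
  ⟦ zipT e f ⟧ ρ ≡ zip (⟦ e ⟧ ρ) (⟦ f ⟧ ρ)
zipT-correct {Γ} {σ} {τ} e f ρ = trans (cong reverse (go (⟦ e ⟧ ρ) [] (⟦ f ⟧ ρ)))
    (reverse-onto (zip (⟦ e ⟧ ρ) (⟦ f ⟧ ρ)))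
  where
  step : List (Val σ × Val τ) × List (Val τ) → Val σ → List (Val σ × Val τ) × List (Val τ)
  step a x = ⟦ uncons (snd v1) v1 (pair (pair v2 v0 ▹ fst v3) v1) ⟧ (x ∷ a ∷ ρ)

  stuck : ∀ xs out → foldl step (out , []) xs ≡ (out , [])
  stuck []       out = refl
  stuck (x ∷ xs) out = stuck xs out

  go : ∀ xs out ys → proj₁ (foldl step (out , ys) xs) ≡ foldl (flip _∷_) out (zip xs ys)
  go []       out ys       = refl
  go (x ∷ xs) out []       = cong proj₁ (stuck xs out)
  go (x ∷ xs) out (y ∷ ys) = go xs ((x , y) ∷ out) ys

  reverse-onto : ∀ zs → reverse (foldl (flip _∷_) [] zs) ≡ zs
  reverse-onto = reverse-involutive

any-true⁻ : ∀ {A : Set} {p : A → Bool} xs → any p xs ≡ true → ∃[ x ] x ∈ xs × p x ≡ true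
any-true⁻ {p = p} (x ∷ xs) eq with p x in px
... | true  = x , here refl , px
... | false with any-true⁻ xs eq
...   | y , y∈ , py = y , there y∈ , py

any-true⁺ : ∀ {A : Set} {p : A → Bool} {x xs} → x ∈ xs → p x ≡ true → any p xs ≡ true
any-true⁺ (here refl) px rewrite px = refl
any-true⁺ {p = p} {xs = y ∷ _} (there x∈) px with p y
... | true  = refl
... | false = any-true⁺ x∈ px

all-true⁻ : ∀ {A : Set} {p : A → Bool} xs → all p xs ≡ true → ∀ {x} → x ∈ xs → p x ≡ true
all-true⁻ {p = p} (x ∷ xs) eq x∈ with p x in px
all-true⁻ (x ∷ xs) eq (here refl) | true = px
all-true⁻ (x ∷ xs) eq (there x∈)  | true = all-true⁻ xs eq x∈

all-true⁺ : ∀ {A : Set} {p : A → Bool} xs → (∀ {x} → x ∈ xs → p x ≡ true) → all p xs ≡ true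
all-true⁺ []       h = refl
all-true⁺ (x ∷ xs) h rewrite h (here refl) = all-true⁺ xs (h ∘ there)

∈-filterᵇ⁻ : ∀ {A : Set} {p : A → Bool} {x} xs → x ∈ filterᵇ p xs → x ∈ xs × p x ≡ true
∈-filterᵇ⁻ {p = p} (y ∷ xs) x∈ with p y in py
∈-filterᵇ⁻ (y ∷ xs) (here refl) | true = here refl , py
∈-filterᵇ⁻ (y ∷ xs) (there x∈)  | true = let x∈′ , px = ∈-filterᵇ⁻ xs x∈ in there x∈′ , px
∈-filterᵇ⁻ (y ∷ xs) x∈          | false = let x∈′ , px = ∈-filterᵇ⁻ xs x∈ in there x∈′ , px

∈-filterᵇ⁺ : ∀ {A : Set} {p : A → Bool} {x xs} → x ∈ xs → p x ≡ true → x ∈ filterᵇ p xs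
∈-filterᵇ⁺ (here refl) px rewrite px = here refl
∈-filterᵇ⁺ {p = p} {xs = y ∷ _} (there x∈) px with p y
... | true  = there (∈-filterᵇ⁺ x∈ px)
... | false = ∈-filterᵇ⁺ x∈ px

trace : Ty
trace = list bool

sameT : ∀ {Γ} → bool ∈ Γ → bool ∈ Γ → Tm Γ bool
sameT x y = ite (var x) (var y) (ite (var y) (bit false) (bit true))

private
  xnor : Bool → Bool → Bool
  xnor x y = if x then y else (if y then false else true)

  equal : List Bool → List Bool → Bool
  equal []       []       = true
  equal []       (_ ∷ _)  = false
  equal (_ ∷ _)  []       = false
  equal (x ∷ xs) (y ∷ ys) = xnor x y ∧ equal xs ys

  equal⇒≡ : ∀ xs ys → equal xs ys ≡ true → xs ≡ ys
  equal⇒≡ []           []           eq = refl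
  equal⇒≡ (true ∷ xs)  (true ∷ ys)  eq = cong (true ∷_) (equal⇒≡ xs ys eq)
  equal⇒≡ (false ∷ xs) (false ∷ ys) eq = cong (false ∷_) (equal⇒≡ xs ys eq)

  equal-refl : ∀ xs → equal xs xs ≡ true
  equal-refl []           = refl
  equal-refl (true ∷ xs)  = equal-refl xs
  equal-refl (false ∷ xs) = equal-refl xs

opaque
  -- The state of the fold is the verdict so far and the unread rest of the second list. The final
  -- test that this rest is empty rejects a first list that is a proper prefix of the second.
  equalT : Tm (trace ∷ trace ∷ []) bool
  equalT = bind
    (fold v0 (pair (bit true) v1)
      (uncons (snd v1) (pair (bit false) empty)
        (pair (ite (fst v3) (sameT i2 i0) (bit false)) v1)))
    (ite (fst v0) (uncons (snd v0) (bit true) (bit false)) (bit false))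

  equalT-correct : ∀ xs ys → ⟦ equalT ⟧ (xs ∷ ys ∷ []) ≡ equal xs ys
  equalT-correct xs₀ ys₀ = go true xs₀ ys₀
    where
    ρ : Env (trace ∷ trace ∷ [])
    ρ = xs₀ ∷ ys₀ ∷ []

    step : Bool × List Bool → Bool → Bool × List Bool
    step a x = ⟦ uncons (snd v1) (pair (bit false) empty)
      (pair (ite (fst v3) (sameT i2 i0) (bit false)) v1) ⟧ (x ∷ a ∷ ρ)

    end : Bool × List Bool → Bool
    end a = ⟦ ite (fst v0) (uncons (snd v0) (bit true) (bit false)) (bit false) ⟧ (a ∷ ρ)

    failed : ∀ ys xs → end (foldl step (false , ys) xs) ≡ false
    failed ys       []       = refl
    failed []       (x ∷ xs) = failed [] xs
    failed (y ∷ ys) (x ∷ xs) = failed ys xs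

    go : ∀ b xs ys → end (foldl step (b , ys) xs) ≡ b ∧ equal xs ys
    go false xs       ys       = failed ys xs
    go true  []       []       = refl
    go true  []       (y ∷ ys) = refl
    go true  (x ∷ xs) []       = failed [] xs
    go true  (x ∷ xs) (y ∷ ys) = go (xnor x y) xs ys

opaque
  memberT : Tm (trace ∷ list trace ∷ []) bool
  memberT = anyT v1 (app equalT (i0 ∷ i1 ∷ []))

  memberT⁻ : ∀ {x L} → ⟦ memberT ⟧ (x ∷ L ∷ []) ≡ true → x ∈ L
  memberT⁻ {x} {L} eq
    with any-true⁻ L (trans (sym (anyT-correct v1 (app equalT (i0 ∷ i1 ∷ [])) (x ∷ L ∷ []))) eq)
  ... | y , y∈L , eq′ = subst (_∈ L) (equal⇒≡ y x (trans (sym (equalT-correct y x)) eq′)) y∈L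

  memberT⁺ : ∀ {x L} → x ∈ L → ⟦ memberT ⟧ (x ∷ L ∷ []) ≡ true
  memberT⁺ {x} {L} x∈L = trans (anyT-correct v1 (app equalT (i0 ∷ i1 ∷ [])) (x ∷ L ∷ []))
    (any-true⁺ x∈L (trans (equalT-correct x x) (equal-refl x)))

-- Traces come one per vertex, yet on a core of bounded size there are boundedly many different
-- ones, so what remains is small. The membership test searches only the accumulator, which is
-- itself free of duplicates.
dedupT : Tm (list trace ∷ []) (list trace)
dedupT = fold v0 empty (ite (app memberT (i0 ∷ i1 ∷ [])) v1 (v0 ▹ v1))

dedupStep : List (List Bool) → List Bool → List (List Bool)
dedupStep L x = if ⟦ memberT ⟧ (x ∷ L ∷ []) then L else x ∷ L

dedupStep-unique : ∀ {L} x → Unique L → Unique (dedupStep L x)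
dedupStep-unique {L} x u with ⟦ memberT ⟧ (x ∷ L ∷ []) in eq
... | true  = u
... | false = ¬Any⇒All¬ L (λ x∈L → false≢true (trans (sym eq) (memberT⁺ x∈L))) ∷ u
  where false≢true : false ≢ true
        false≢true ()

∈-dedupStep⁻ : ∀ {L y} x → y ∈ dedupStep L x → y ∈ L ⊎ y ≡ x
∈-dedupStep⁻ {L} x y∈ with ⟦ memberT ⟧ (x ∷ L ∷ [])
∈-dedupStep⁻ x y∈          | true  = inj₁ y∈
∈-dedupStep⁻ x (here refl) | false = inj₂ refl
∈-dedupStep⁻ x (there y∈)  | false = inj₁ y∈

∈-dedupStep⁺ : ∀ {L} x → x ∈ dedupStep L x × (∀ {y} → y ∈ L → y ∈ dedupStep L x)
∈-dedupStep⁺ {L} x with ⟦ memberT ⟧ (x ∷ L ∷ []) in eq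
... | true  = memberT⁻ eq , λ y∈ → y∈
... | false = here refl , there

dedup : List (List Bool) → List (List Bool)
dedup xs = ⟦ dedupT ⟧ (xs ∷ [])

dedup-unique : ∀ xs → Unique (dedup xs)
dedup-unique xs = go [] xs []
  where
  go : ∀ L xs → Unique L → Unique (foldl dedupStep L xs)
  go L []       u = u
  go L (x ∷ xs) u = go _ xs (dedupStep-unique x u)

∈-dedup⁻ : ∀ {x} xs → x ∈ dedup xs → x ∈ xs
∈-dedup⁻ xs x∈ with go [] xs x∈
  where
  go : ∀ {x} L xs → x ∈ foldl dedupStep L xs → x ∈ L ⊎ x ∈ xs
  go L []       x∈ = inj₁ x∈
  go L (y ∷ xs) x∈ with go _ xs x∈
  ... | inj₂ x∈xs = inj₂ (there x∈xs)
  ... | inj₁ x∈L with ∈-dedupStep⁻ y x∈L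
  ...   | inj₁ x∈L′ = inj₁ x∈L′
  ...   | inj₂ refl = inj₂ (here refl)
... | inj₂ x∈xs = x∈xs

∈-dedup⁺ : ∀ {x xs} → x ∈ xs → x ∈ dedup xs
∈-dedup⁺ {xs = xs} = go xs
  where
  keep : ∀ {x L} xs → x ∈ L → x ∈ foldl dedupStep L xs
  keep []       x∈ = x∈
  keep {L = L} (y ∷ xs) x∈ = keep xs (proj₂ (∈-dedupStep⁺ {L} y) x∈)

  go : ∀ {x L} xs → x ∈ xs → x ∈ foldl dedupStep L xs
  go {L = L} (x ∷ xs) (here refl) = keep xs (proj₁ (∈-dedupStep⁺ {L} x))
  go (x ∷ xs) (there x∈)  = go xs x∈

opaque
  orT : Tm (trace ∷ trace ∷ []) trace
  orT = mapT (zipT v0 v1) (ite (fst v0) (bit true) (snd v0))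

  or-map : ∀ {A : Set} (f g : A → Bool) cs →
    ⟦ orT ⟧ (map f cs ∷ map g cs ∷ []) ≡ map (λ c → f c ∨ g c) cs
  or-map f g cs = trans (mapT-correct (zipT v0 v1) (ite (fst v0) (bit true) (snd v0)) ρ)
    (trans (cong (map pointwise) (zipT-correct v0 v1 ρ)) (go cs))
    where
    ρ : Env (trace ∷ trace ∷ [])
    ρ = map f cs ∷ map g cs ∷ []
    pointwise : Bool × Bool → Bool
    pointwise (x , y) = if x then true else y
    go : ∀ cs → map pointwise (zip (map f cs) (map g cs)) ≡ map (λ c → f c ∨ g c) cs
    go []       = refl
    go (c ∷ cs) with f c
    ... | true  = cong (true ∷_) (go cs)
    ... | false = cong (g c ∷_) (go cs)

opaque
  -- The counterpart of `Jump` for tuples of traces. The context holds the old tuple, the new tuple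
  -- and the list of traces from which the one additional entry may be taken.
  moveT : Tm (list trace ∷ list trace ∷ list trace ∷ []) bool
  moveT = anyT v2 (bind (v0 ▹ v1) (allT v3 (app memberT (i0 ∷ i1 ∷ []))))

  move⁻ : ∀ {a b L} → ⟦ moveT ⟧ (a ∷ b ∷ L ∷ []) ≡ true →
          ∃[ t ] t ∈ L × (∀ {x} → x ∈ b → x ∈ t ∷ a)
  move⁻ {a} {b} {L} eq
    with any-true⁻ L (trans
        (sym (anyT-correct v2 (bind (v0 ▹ v1) (allT v3 (app memberT (i0 ∷ i1 ∷ []))))
            (a ∷ b ∷ L ∷ []))) eq)
  ... | t , t∈L , eq′ = t , t∈L , λ x∈b → memberT⁻ (all-true⁻ b
    (trans (sym (allT-correct v3 (app memberT (i0 ∷ i1 ∷ [])) ((t ∷ a) ∷ t ∷ a ∷ b ∷ L ∷ []))) eq′) x∈b)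

  move⁺ : ∀ {a b L t} → t ∈ L → (∀ {x} → x ∈ b → x ∈ t ∷ a) →
          ⟦ moveT ⟧ (a ∷ b ∷ L ∷ []) ≡ true
  move⁺ {a} {b} {L} {t} t∈L b⊆ =
    trans (anyT-correct v2 (bind (v0 ▹ v1) (allT v3 (app memberT (i0 ∷ i1 ∷ [])))) (a ∷ b ∷ L ∷ []))
    (any-true⁺ t∈L
      (trans (allT-correct v3 (app memberT (i0 ∷ i1 ∷ [])) ((t ∷ a) ∷ t ∷ a ∷ b ∷ L ∷ []))
        (all-true⁺ b (memberT⁺ ∘ b⊆))))

opaque
  domT : Tm (list trace ∷ []) bool
  -- The union starts from the first trace, since the length of an all-`false` trace is not at hand.
  -- The default `false` concerns the empty tuple only, whereas configurations have length `suc k`.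
  domT = uncons v0 (bit false) (allT (fold v1 v0 (app orT (i1 ∷ i0 ∷ []))) v0)

opaque
  -- The list of bits is a unary counter. Starting from single traces and uniting once more for each
  -- bit yields the unions of `length ks + 1` traces; this is where the number k+1 in the definition
  -- of the core comes from.
  unionsT : Tm (list trace ∷ list bool ∷ []) (list trace)
  unionsT = fold v1 v0 (productT v1 i2 orT)

opaque
  missesT : Tm (list trace ∷ list bool ∷ []) bool
  -- The head bit belongs to the new vertex, whose row was prepended last, and must be `false`; the
  -- other bits belong to the core and must be `true`.
  missesT = anyT unionsT (uncons v0 (bit false) (ite v0 (bit false) (allT v1 v0)))

-- Traces of vertices and of tuples

module Traces {V : Set} (N : V → V → Bool) where

  hits : List V → V → Bool
  hits ws c = any (N c) ws

  column : List V → V → List Bool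
  column cs w = map (λ c → N c w) cs

  opaque
    unfolding domT

    domT-correct : ∀ cs w ws → ⟦ domT ⟧ (map (column cs) (w ∷ ws) ∷ []) ≡ all (hits (w ∷ ws)) cs
    domT-correct cs w ws =
      trans (allT-correct (fold v1 v0 (app orT (i1 ∷ i0 ∷ []))) v0
              (column cs w ∷ map (column cs) ws ∷ map (column cs) (w ∷ ws) ∷ []))
      (trans (cong (all (λ b → b)) (go (λ c → N c w) ws)) (all-map (hits (w ∷ ws)) cs))
      where
      go : ∀ h ws → foldl (λ a x → ⟦ orT ⟧ (a ∷ x ∷ [])) (map h cs) (map (column cs) ws)
                    ≡ map (λ c → h c ∨ hits ws c) cs
      go h []       = map-cong (λ c → sym (∨-identityʳ (h c))) cs
      go h (w ∷ ws) rewrite or-map h (λ c → N c w) cs =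
        trans (go (λ c → h c ∨ N c w) ws) (map-cong (λ c → ∨-assoc (h c) (N c w) (hits ws c)) cs)
      all-map : ∀ (h : V → Bool) cs → all (λ b → b) (map h cs) ≡ all h cs
      all-map h []       = refl
      all-map h (c ∷ cs) = cong (h c ∧_) (all-map h cs)

  private
    unions : List (List Bool) → List Bool → List (List Bool) → List (List Bool)
    unions L ks U = foldl (λ U _ → cartesianProductWith (λ x y → ⟦ orT ⟧ (y ∷ x ∷ [])) U L) U ks

    opaque
      unfolding unionsT

      unionsT-correct : ∀ L ks → ⟦ unionsT ⟧ (L ∷ ks ∷ []) ≡ unions L ks L
      unionsT-correct L ks =
        foldl-cong (λ U k → productT-correct v1 i2 orT (k ∷ U ∷ L ∷ ks ∷ [])) L ks

    singleton : ∀ cs w → column cs w ≡ map (hits (w ∷ [])) cs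
    singleton cs w = map-cong (λ c → sym (∨-identityʳ (N c w))) cs

  module _ (cs : List V) (L : List (List Bool))
           (L⊆ : ∀ {x} → x ∈ L → ∃[ w ] x ≡ column cs w) (⊆L : ∀ w → column cs w ∈ L) where

    private
      unions⁻ : ∀ {U j} ks → (∀ {x} → x ∈ U → ∃[ ws ] length ws ≡ j × x ≡ map (hits ws) cs) →
                ∀ {x} → x ∈ unions L ks U → ∃[ ws ] length ws ≡ length ks + j × x ≡ map (hits ws) cs
      unions⁻ []       h x∈ = h x∈
      unions⁻ {U} {j} (k ∷ ks) h x∈ with unions⁻ {j = suc j} ks h′ x∈
        where
        h′ : ∀ {x} → x ∈ cartesianProductWith (λ x y → ⟦ orT ⟧ (y ∷ x ∷ [])) U L →
             ∃[ ws ] length ws ≡ suc j × x ≡ map (hits ws) cs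
        h′ x∈ with ∈-cartesianProductWith⁻ (λ x y → ⟦ orT ⟧ (y ∷ x ∷ [])) U L x∈
        ... | u , y , u∈ , y∈ , refl with h u∈ | L⊆ y∈
        ... | ws , len , refl | w , refl = w ∷ ws , cong suc len , or-map (λ c → N c w) (hits ws) cs
      ... | ws , len , eq = ws , trans len (+-suc (length ks) j) , eq

      unions⁺ : ∀ {U j} ks → (∀ ws → length ws ≡ j → map (hits ws) cs ∈ U) →
                ∀ ws → length ws ≡ length ks + j → map (hits ws) cs ∈ unions L ks U
      unions⁺ [] h ws len = h ws len
      unions⁺ {U} {j} (k ∷ ks) h ws len = unions⁺ {j = suc j} ks h′ ws
          (trans len (sym (+-suc (length ks) j)))
        where
        h′ : ∀ ws → length ws ≡ suc j →
             map (hits ws) cs ∈ cartesianProductWith (λ x y → ⟦ orT ⟧ (y ∷ x ∷ [])) U L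
        h′ (w ∷ ws) refl = subst (_∈ cartesianProductWith (λ x y → ⟦ orT ⟧ (y ∷ x ∷ [])) U L)
          (or-map (λ c → N c w) (hits ws) cs)
          (∈-cartesianProductWith⁺ (λ x y → ⟦ orT ⟧ (y ∷ x ∷ [])) (h ws refl) (⊆L w))

    unionsT⁻ : ∀ {x} ks → x ∈ ⟦ unionsT ⟧ (L ∷ ks ∷ []) →
               ∃[ ws ] length ws ≡ length ks + 1 × x ≡ map (hits ws) cs
    unionsT⁻ ks x∈ = unions⁻ ks base (subst (_ ∈_) (unionsT-correct L ks) x∈)
      where
      base : ∀ {x} → x ∈ L → ∃[ ws ] length ws ≡ 1 × x ≡ map (hits ws) cs
      base x∈ with L⊆ x∈
      ... | w , refl = w ∷ [] , refl , singleton cs w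

    unionsT⁺ : ∀ ks ws → length ws ≡ length ks + 1 → map (hits ws) cs ∈ ⟦ unionsT ⟧ (L ∷ ks ∷ [])
    unionsT⁺ ks ws len = subst (map (hits ws) cs ∈_) (sym (unionsT-correct L ks))
        (unions⁺ ks base ws len)
      where
      base : ∀ ws → length ws ≡ 1 → map (hits ws) cs ∈ L
      base (w ∷ []) refl = subst (_∈ L) (singleton cs w) (⊆L w)

  module _ (v : V) (cs : List V) (L : List (List Bool))
           (L⊆ : ∀ {x} → x ∈ L → ∃[ w ] x ≡ column (v ∷ cs) w) (⊆L : ∀ w → column (v ∷ cs) w ∈ L) where

    private
      test : Tm (trace ∷ list trace ∷ list bool ∷ []) bool
      test = uncons v0 (bit false) (ite v0 (bit false) (allT v1 v0))

      all-id : ∀ (h : V → Bool) cs x ys zs us →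
        ⟦ allT {Γ = bool ∷ trace ∷ trace ∷ list trace ∷ list bool ∷ []} v1 v0 ⟧
          (x ∷ map h cs ∷ ys ∷ zs ∷ us ∷ []) ≡ all h cs
      all-id h cs x ys zs us = trans (allT-correct v1 v0 (x ∷ map h cs ∷ ys ∷ zs ∷ us ∷ [])) (go cs)
        where
        go : ∀ cs → all (λ b → b) (map h cs) ≡ all h cs
        go []       = refl
        go (c ∷ cs) = cong (h c ∧_) (go cs)

    opaque
      unfolding missesT

      missesT⁻ : ∀ ks → ⟦ missesT ⟧ (L ∷ ks ∷ []) ≡ true →
        ∃[ ws ] length ws ≡ length ks + 1 × hits ws v ≡ false × (∀ {c} → c ∈ cs → hits ws c ≡ true)
      missesT⁻ ks eq
        with any-true⁻ (⟦ unionsT ⟧ (L ∷ ks ∷ []))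
            (trans (sym (anyT-correct unionsT test (L ∷ ks ∷ []))) eq)
      ... | x , x∈ , eq′ with unionsT⁻ (v ∷ cs) L L⊆ ⊆L ks x∈
      ... | ws , len , refl with hits ws v in eqv
      ... | false = ws , len , eqv , all-true⁻ cs
          (trans (sym (all-id (hits ws) cs false (false ∷ map (hits ws) cs) L ks)) eq′)

      missesT⁺ : ∀ ks ws → length ws ≡ length ks + 1 → hits ws v ≡ false →
        (∀ {c} → c ∈ cs → hits ws c ≡ true) → ⟦ missesT ⟧ (L ∷ ks ∷ []) ≡ true
      missesT⁺ ks ws len miss hit =
        trans (anyT-correct unionsT test (L ∷ ks ∷ []))
          (any-true⁺ (unionsT⁺ (v ∷ cs) L L⊆ ⊆L ks ws len) holds)
        where
        holds : ⟦ test ⟧ (map (hits ws) (v ∷ cs) ∷ L ∷ ks ∷ []) ≡ true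
        holds rewrite miss = trans (all-id (hits ws) cs false (false ∷ map (hits ws) cs) L ks)
            (all-true⁺ cs hit)

-- Reachability by saturation

module Search {X : Set} (nodes : List X) (m : X → X → Bool) where

  expand : List X → List X
  expand R = filterᵇ (λ b → any (λ a → m a b) R) nodes

  iterate : ∀ {K : Set} → List K → List X → List X
  iterate ks R = foldl (λ R _ → expand R) R ks

  -- The list of nodes doubles as the counter: if `m` is reflexive on nodes, a round that changes
  -- anything adds a node, so this many rounds reach a fixed point.
  reached : X → List X
  reached s = iterate nodes (filterᵇ (m s) nodes)

closureT : Tm (list (list trace) ∷ list trace ∷ list trace ∷ list trace ∷ []) (list (list trace))
closureT = fold v0 (filterT v0 (app moveT (i3 ∷ i0 ∷ i2 ∷ [])))
  (filterT v2 (anyT v2 (app moveT (i0 ∷ i1 ∷ i5 ∷ []))))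

opaque
  searchT : Tm (list (list trace) ∷ list trace ∷ list trace ∷ list trace ∷ []) bool
  -- Instead of comparing tuples, the target is recognised by one more move, which costs nothing
  -- because moves are reflexive on nodes.
  searchT = anyT closureT (app moveT (i0 ∷ i4 ∷ i2 ∷ []))

  searchT-correct : ∀ nodes L ls lt → ⟦ searchT ⟧ (nodes ∷ L ∷ ls ∷ lt ∷ []) ≡
    any (λ a → ⟦ moveT ⟧ (a ∷ lt ∷ L ∷ []))
        (Search.reached nodes (λ a b → ⟦ moveT ⟧ (a ∷ b ∷ L ∷ [])) ls)
  searchT-correct nodes L ls lt = trans
    (anyT-correct closureT (app moveT (i0 ∷ i4 ∷ i2 ∷ [])) ρ)
    (cong (any (λ a → ⟦ moveT ⟧ (a ∷ lt ∷ L ∷ []))) (trans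
      (foldl-cong expand-correct (⟦ filterT v0 (app moveT (i3 ∷ i0 ∷ i2 ∷ [])) ⟧ ρ) nodes)
      (cong (iterate nodes) (filterT-correct v0 (app moveT (i3 ∷ i0 ∷ i2 ∷ [])) ρ))))
    where
    open Search nodes (λ a b → ⟦ moveT ⟧ (a ∷ b ∷ L ∷ []))
    ρ : Env (list (list trace) ∷ list trace ∷ list trace ∷ list trace ∷ [])
    ρ = nodes ∷ L ∷ ls ∷ lt ∷ []
    filterᵇ-cong : ∀ {A : Set} {p q : A → Bool} → (∀ x → p x ≡ q x) → ∀ xs → filterᵇ p xs ≡ filterᵇ q xs
    filterᵇ-cong p≡q [] = refl
    filterᵇ-cong {p = p} {q} p≡q (x ∷ xs) rewrite p≡q x with q x
    ... | true  = cong (x ∷_) (filterᵇ-cong p≡q xs)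
    ... | false = filterᵇ-cong p≡q xs
    expand-correct : ∀ R (x : List (List Bool)) →
        ⟦ filterT v2 (anyT v2 (app moveT (i0 ∷ i1 ∷ i5 ∷ []))) ⟧ (x ∷ R ∷ ρ) ≡ expand R
    expand-correct R x = trans
      (filterT-correct v2 (anyT v2 (app moveT (i0 ∷ i1 ∷ i5 ∷ []))) (x ∷ R ∷ ρ))
      (filterᵇ-cong (λ b → anyT-correct v2 (app moveT (i0 ∷ i1 ∷ i5 ∷ [])) (b ∷ x ∷ R ∷ ρ)) nodes)

-- The start tuple serves as the counter, so the tuples built have its length.
tuplesT : Tm (list trace ∷ list trace ∷ list trace ∷ []) (list (list trace))
tuplesT = fold v1 (empty ▹ empty) (productT v2 i1 (v1 ▹ v0))

opaque
  nodesT : Tm (list trace ∷ list trace ∷ list trace ∷ []) (list (list trace))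
  nodesT = filterT tuplesT (app domT (i0 ∷ []))

reachableT : Tm (list trace ∷ list trace ∷ list trace ∷ []) bool
reachableT = bind nodesT searchT

module Saturation {X : Set} (nodes : List X) (m : X → X → Bool)
                  (m-refl : ∀ {a} → a ∈ nodes → m a a ≡ true) where

  open Search nodes m

  Step : X → X → Set
  Step a b = m a b ≡ true × b ∈ nodes

  private
    -- Both sides are sublists of one list in the same order, so equality of the selected elements
    -- is already equality of lists, and any other inclusion shows in the length.
    filter-grows : ∀ {p q : X → Bool} xs → (∀ {x} → x ∈ xs → p x ≡ true → q x ≡ true) →
      filterᵇ p xs ≡ filterᵇ q xs ⊎ length (filterᵇ p xs) < length (filterᵇ q xs)
    filter-grows [] p⇒q = inj₁ refl
    filter-grows {p} {q} (x ∷ xs) p⇒q with p x in px | q x in qx | filter-grows {p} {q} xs (p⇒q ∘ there)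
    ... | true  | true  | inj₁ eq = inj₁ (cong (x ∷_) eq)
    ... | true  | true  | inj₂ lt = inj₂ (s≤s lt)
    ... | true  | false | _       with () ← trans (sym qx) (p⇒q (here refl) px)
    ... | false | true  | inj₁ eq = inj₂ (s≤s (≤-reflexive (cong length eq)))
    ... | false | true  | inj₂ lt = inj₂ (s≤s (<⇒≤ lt))
    ... | false | false | ih      = ih

    filter-length : ∀ (p : X → Bool) xs → length (filterᵇ p xs) ≤ length xs
    filter-length p []       = z≤n
    filter-length p (x ∷ xs) with p x
    ... | true  = s≤s (filter-length p xs)
    ... | false = ≤-trans (filter-length p xs) (n≤1+n _)

    stays : ∀ {K : Set} (ks : List K) {R} → R ≡ expand R → iterate ks R ≡ R
    stays []       eq = refl
    stays (k ∷ ks) eq = trans (cong (iterate ks) (sym eq)) (stays ks eq)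

    grows : ∀ p → let R = filterᵇ p nodes in R ≡ expand R ⊎ length R < length (expand R)
    grows p = filter-grows nodes λ {x} x∈ px → any-true⁺ (∈-filterᵇ⁺ x∈ px) (m-refl x∈)

    -- Once a round changes nothing, neither does any later one; until then each round contributes a
    -- node. With as many rounds as nodes, the second alternative would require more nodes than
    -- there are.
    progress : ∀ {K : Set} (ks : List K) p → let R = iterate ks (filterᵇ p nodes) in
      R ≡ expand R ⊎ length ks + length (filterᵇ p nodes) < length (expand R)
    progress []       p = grows p
    progress (k ∷ ks) p with grows p | progress ks (λ b → any (λ a → m a b) (filterᵇ p nodes))
    ... | _       | inj₁ stable = inj₁ stable
    ... | inj₁ eq | inj₂ _      = inj₁ (trans (cong (iterate ks) (sym eq))
                                    (trans (stays ks eq) (trans eq (cong expand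
                                      (trans (sym (stays ks eq)) (cong (iterate ks) eq))))))
    ... | inj₂ lt | inj₂ lt′    = inj₂
        (≤-trans (s≤s (≤-trans (≤-reflexive (sym (+-suc (length ks) _)))
            (+-monoʳ-≤ (length ks) lt))) lt′)

    closed : ∀ p → let R = iterate nodes (filterᵇ p nodes) in R ≡ expand R
    closed p with progress nodes p
    ... | inj₁ eq = eq
    ... | inj₂ lt with () ← <-irrefl refl (≤-trans lt (≤-trans (filter-length _ nodes) (m≤m+n _ _)))

    sound : ∀ {K : Set} {s} (ks : List K) {R} → (∀ {a} → a ∈ R → Star Step s a) →
            ∀ {a} → a ∈ iterate ks R → Star Step s a
    sound []       h a∈ = h a∈
    sound (k ∷ ks) {R} h a∈ = sound ks h′ a∈
      where
      h′ : ∀ {b} → b ∈ expand R → Star Step _ b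
      h′ b∈ with ∈-filterᵇ⁻ nodes b∈
      ... | b∈N , eq with any-true⁻ R eq
      ... | a , a∈ , mab = h a∈ ◅◅ ((mab , b∈N) ◅ ε)

    kept : ∀ {K : Set} (ks : List K) p {x} → x ∈ filterᵇ p nodes → x ∈ iterate ks (filterᵇ p nodes)
    kept []       p x∈ = x∈
    kept (k ∷ ks) p x∈ = kept ks _ (∈-filterᵇ⁺ (proj₁ (∈-filterᵇ⁻ nodes x∈))
      (any-true⁺ x∈ (m-refl (proj₁ (∈-filterᵇ⁻ nodes x∈)))))


  module _ {s t : X} (s∈ : s ∈ nodes) (t∈ : t ∈ nodes) where

    saturate⁻ : any (λ a → m a t) (reached s) ≡ true → Star Step s t
    saturate⁻ eq with any-true⁻ (reached s) eq
    ... | a , a∈ , mat = sound nodes start a∈ ◅◅ ((mat , t∈) ◅ ε)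
      where
      start : ∀ {a} → a ∈ filterᵇ (m s) nodes → Star Step s a
      start a∈ with ∈-filterᵇ⁻ nodes a∈
      ... | a∈N , msa = (msa , a∈N) ◅ ε

    saturate⁺ : Star Step s t → any (λ a → m a t) (reached s) ≡ true
    saturate⁺ path = any-true⁺ (follow path (kept nodes (m s) (∈-filterᵇ⁺ s∈ (m-refl s∈)))) (m-refl t∈)
      where
      follow : ∀ {a b} → Star Step a b → a ∈ reached s → b ∈ reached s
      follow ε                  a∈ = a∈
      follow ((mab , b∈) ◅ path) a∈ =
        follow path (subst (_ ∈_) (sym (closed (m s))) (∈-filterᵇ⁺ b∈ (any-true⁺ a∈ mab)))

private
  tuples : List (List Bool) → List (List Bool) → List (List (List Bool)) → List (List (List Bool))
  tuples L ks T = foldl (λ T _ → cartesianProductWith _∷_ L T) T ks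

  tuplesT-correct : ∀ L ls lt → ⟦ tuplesT ⟧ (L ∷ ls ∷ lt ∷ []) ≡ tuples L ls ([] ∷ [])
  tuplesT-correct L ls lt =
    foldl-cong (λ T l → productT-correct v2 i1 (v1 ▹ v0) (l ∷ T ∷ L ∷ ls ∷ lt ∷ [])) ([] ∷ []) ls

  tuples⁻ : ∀ {L T j} ls → (∀ {a} → a ∈ T → length a ≡ j × (∀ {x} → x ∈ a → x ∈ L)) →
            ∀ {a} → a ∈ tuples L ls T → length a ≡ length ls + j × (∀ {x} → x ∈ a → x ∈ L)
  tuples⁻ []       h a∈ = h a∈
  tuples⁻ {L} {T} {j} (l ∷ ls) h a∈ with tuples⁻ {j = suc j} ls h′ a∈
    where
    h′ : ∀ {a} → a ∈ cartesianProductWith _∷_ L T → length a ≡ suc j × (∀ {x} → x ∈ a → x ∈ L)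
    h′ a∈ with ∈-cartesianProductWith⁻ _∷_ L T a∈
    ... | x , a , x∈ , a∈ , refl with h a∈
    ... | len , a⊆ = cong suc len , λ { (here refl) → x∈ ; (there y∈) → a⊆ y∈ }
  ... | len , a⊆ = trans len (+-suc (length ls) j) , a⊆

  tuples⁺ : ∀ {L T j} ls → (∀ a → length a ≡ j → (∀ {x} → x ∈ a → x ∈ L) → a ∈ T) →
            ∀ a → length a ≡ length ls + j → (∀ {x} → x ∈ a → x ∈ L) → a ∈ tuples L ls T
  tuples⁺ [] h a len a⊆ = h a len a⊆
  tuples⁺ {L} {T} {j} (l ∷ ls) h a len a⊆ =
    tuples⁺ {j = suc j} ls h′ a (trans len (sym (+-suc (length ls) j))) a⊆
    where
    h′ : ∀ a → length a ≡ suc j → (∀ {x} → x ∈ a → x ∈ L) → a ∈ cartesianProductWith _∷_ L T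
    h′ (x ∷ a) refl a⊆ = ∈-cartesianProductWith⁺ _∷_ (a⊆ (here refl)) (h a refl (a⊆ ∘ there))

tuplesT⁻ : ∀ {L ls lt a} → a ∈ ⟦ tuplesT ⟧ (L ∷ ls ∷ lt ∷ []) →
           length a ≡ length ls × (∀ {x} → x ∈ a → x ∈ L)
tuplesT⁻ {L} {ls} {lt} {a} a∈
  with tuples⁻ ls (λ { (here refl) → refl , λ () }) (subst (a ∈_) (tuplesT-correct L ls lt) a∈)
... | len , a⊆ = trans len (+-identityʳ (length ls)) , a⊆

tuplesT⁺ : ∀ {L ls lt} a → length a ≡ length ls → (∀ {x} → x ∈ a → x ∈ L) →
           a ∈ ⟦ tuplesT ⟧ (L ∷ ls ∷ lt ∷ [])
tuplesT⁺ {L} {ls} {lt} a len a⊆ = subst (a ∈_) (sym (tuplesT-correct L ls lt))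
  (tuples⁺ ls (λ { [] refl _ → here refl }) a (trans len (sym (+-identityʳ (length ls)))) a⊆)

opaque
  unfolding nodesT

  nodesT⁻ : ∀ {L ls lt a} → a ∈ ⟦ nodesT ⟧ (L ∷ ls ∷ lt ∷ []) →
            length a ≡ length ls × (∀ {x} → x ∈ a → x ∈ L) × ⟦ domT ⟧ (a ∷ []) ≡ true
  nodesT⁻ {L} {ls} {lt} {a} a∈
    with ∈-filterᵇ⁻ (⟦ tuplesT ⟧ (L ∷ ls ∷ lt ∷ []))
           (subst (a ∈_) (filterT-correct tuplesT (app domT (i0 ∷ [])) (L ∷ ls ∷ lt ∷ [])) a∈)
  ... | a∈T , eq with tuplesT⁻ {L} {ls} {lt} a∈T
  ... | len , a⊆ = len , a⊆ , eq

  nodesT⁺ : ∀ {L ls lt} a → length a ≡ length ls → (∀ {x} → x ∈ a → x ∈ L) →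
            ⟦ domT ⟧ (a ∷ []) ≡ true → a ∈ ⟦ nodesT ⟧ (L ∷ ls ∷ lt ∷ [])
  nodesT⁺ {L} {ls} {lt} a len a⊆ eq =
    subst (a ∈_) (sym (filterT-correct tuplesT (app domT (i0 ∷ [])) (L ∷ ls ∷ lt ∷ [])))
      (∈-filterᵇ⁺ (tuplesT⁺ {L} {ls} {lt} a len a⊆) eq)

-- Configurations are tuples of vertices, possibly with repetitions.  A
-- jump may permute and duplicate entries at will and bring in one vertex.
module Jumps {V : Set} (N : V → V → Bool) (cs : List V) (k : ℕ) where
  open Traces N

  Covers : List V → Set
  Covers a = ∀ {c} → c ∈ cs → hits a c ≡ true

  Jump : List V → List V → Set
  Jump a b = length b ≡ suc k × Covers b × ∃[ w ] (∀ {x} → x ∈ b → x ∈ w ∷ a)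

  dom⁺ : ∀ a → length a ≡ suc k → Covers a → ⟦ domT ⟧ (map (column cs) a ∷ []) ≡ true
  dom⁺ (w ∷ ws) _ cov = trans (domT-correct cs w ws) (all-true⁺ cs cov)

  dom⁻ : ∀ a → length a ≡ suc k → ⟦ domT ⟧ (map (column cs) a ∷ []) ≡ true → Covers a
  dom⁻ (w ∷ ws) _ eq = all-true⁻ cs (trans (sym (domT-correct cs w ws)) eq)

  -- Covering depends on traces alone, so entries can be exchanged one at a time for others with the
  -- same trace; `p` is the part already exchanged. The search needs this at its end, where it
  -- yields a tuple that agrees with the target in traces only.
  replace : ∀ p xs ys → map (column cs) xs ≡ map (column cs) ys →
            length (p ++ xs) ≡ suc k → Covers (p ++ xs) → Star Jump (p ++ xs) (p ++ ys)
  replace p []       []       eq len cov = ε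
  replace p (x ∷ xs) (y ∷ ys) eq len cov with ∷-injective eq
  ... | eqxy , eqs = (len′ , cov′ , y , ⊆) ◅
        subst₂ (Star Jump) (++-assoc p (y ∷ []) xs) (++-assoc p (y ∷ []) ys)
          (replace (p ++ y ∷ []) xs ys eqs
            (trans (cong length (++-assoc p (y ∷ []) xs)) len′)
            (subst Covers (sym (++-assoc p (y ∷ []) xs)) cov′))
    where
    same : map (column cs) (p ++ x ∷ xs) ≡ map (column cs) (p ++ y ∷ xs)
    same = trans (map-++ (column cs) p (x ∷ xs))
      (trans (cong (λ t → map (column cs) p ++ t ∷ map (column cs) xs) eqxy)
             (sym (map-++ (column cs) p (y ∷ xs))))
    len′ : length (p ++ y ∷ xs) ≡ suc k
    len′ = trans (sym (length-map (column cs) (p ++ y ∷ xs)))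
      (trans (cong length (sym same)) (trans (length-map (column cs) (p ++ x ∷ xs)) len))
    cov′ : Covers (p ++ y ∷ xs)
    cov′ = dom⁻ (p ++ y ∷ xs) len′
      (subst (λ t → ⟦ domT ⟧ (t ∷ []) ≡ true) same (dom⁺ (p ++ x ∷ xs) len cov))
    ⊆ : ∀ {z} → z ∈ p ++ y ∷ xs → z ∈ y ∷ p ++ x ∷ xs
    ⊆ z∈ with ∈-++⁻ p z∈
    ... | inj₁ z∈p          = there (∈-++⁺ˡ z∈p)
    ... | inj₂ (here refl)  = here refl
    ... | inj₂ (there z∈xs) = there (∈-++⁺ʳ p (there z∈xs))

  -- Preimages are chosen among the entries of `a`, so that lifting a move on traces brings in no
  -- vertex besides the one chosen for the new trace.
  preimage : ∀ a t → (∀ {x} → x ∈ t → x ∈ map (column cs) a) →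
             ∃[ b ] map (column cs) b ≡ t × (∀ {w} → w ∈ b → w ∈ a)
  preimage a []      t⊆ = [] , refl , λ ()
  preimage a (x ∷ t) t⊆ with ∈-map⁻ (column cs) (t⊆ (here refl)) | preimage a t (t⊆ ∘ there)
  ... | w , w∈ , refl | b , refl , b⊆ = w ∷ b , refl , λ { (here refl) → w∈ ; (there v∈) → b⊆ v∈ }

  module _ (L : List (List Bool))
           (L⊆ : ∀ {x} → x ∈ L → ∃[ w ] x ≡ column cs w) (⊆L : ∀ w → column cs w ∈ L)
           {as bs : List V} (as-length : length as ≡ suc k) (bs-length : length bs ≡ suc k)
           (as-covers : Covers as) (bs-covers : Covers bs) where

    private
      ls lt : List (List Bool)
      ls = map (column cs) as
      lt = map (column cs) bs

      nodes : List (List (List Bool))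
      nodes = ⟦ nodesT ⟧ (L ∷ ls ∷ lt ∷ [])

      node⁻ : ∀ {a} → a ∈ nodes →
              length a ≡ suc k × (∀ {x} → x ∈ a → x ∈ L) × ⟦ domT ⟧ (a ∷ []) ≡ true
      node⁻ a∈ with nodesT⁻ {L} {ls} {lt} a∈
      ... | len , rest = trans len (trans (length-map (column cs) as) as-length) , rest

      node⁺ : ∀ a → length a ≡ suc k → Covers a → map (column cs) a ∈ nodes
      node⁺ a len cov = nodesT⁺ {L} {ls} {lt} (map (column cs) a)
        (trans (length-map (column cs) a)
            (trans len (sym (trans (length-map (column cs) as) as-length))))
        in-L (dom⁺ a len cov)
        where
        in-L : ∀ {x} → x ∈ map (column cs) a → x ∈ L
        in-L x∈ with ∈-map⁻ (column cs) x∈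
        ... | w , _ , refl = ⊆L w

      m : List (List Bool) → List (List Bool) → Bool
      m a b = ⟦ moveT ⟧ (a ∷ b ∷ L ∷ [])

      m-refl : ∀ {a} → a ∈ nodes → m a a ≡ true
      m-refl {[]}    a∈ with () ← proj₁ (node⁻ a∈)
      m-refl {x ∷ a} a∈ = move⁺ (proj₁ (proj₂ (node⁻ a∈)) (here refl)) there

      open Saturation nodes m m-refl

      ls∈ : ls ∈ nodes
      ls∈ = node⁺ as as-length as-covers

      lt∈ : lt ∈ nodes
      lt∈ = node⁺ bs bs-length bs-covers

      reachableT-correct : ⟦ reachableT ⟧ (L ∷ ls ∷ lt ∷ [])
          ≡ any (λ a → m a lt) (Search.reached nodes m ls)
      reachableT-correct = searchT-correct nodes L ls lt

      lift : ∀ {a t} → Star Step (map (column cs) a) t → length a ≡ suc k → Covers a →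
             ∃[ b ] map (column cs) b ≡ t × length b ≡ suc k × Covers b × Star Jump a b
      lift {a} ε len cov = a , refl , len , cov , ε
      lift {a} ((ma , b∈) ◅ path) len cov with move⁻ ma
      ... | t , t∈L , b⊆ with L⊆ t∈L
      ... | w , refl with preimage (w ∷ a) _ b⊆ | node⁻ b∈
      ... | b , refl , b⊆′ | len-b , _ , dom-b with trans (sym (length-map (column cs) b)) len-b
      ... | len-b′ with lift path len-b′ (dom⁻ b len-b′ dom-b)
      ... | c , eq , len-c , cov-c , jumps =
        c , eq , len-c , cov-c , (len-b′ , dom⁻ b len-b′ dom-b , w , b⊆′) ◅ jumps

    reachableT⁻ : ⟦ reachableT ⟧ (L ∷ ls ∷ lt ∷ []) ≡ true → Star Jump as bs
    reachableT⁻ eq with lift (saturate⁻ ls∈ lt∈ (trans (sym reachableT-correct) eq)) as-length as-covers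
    ... | b , same , len , cov , jumps = jumps ◅◅ replace [] b bs same len cov

    reachableT⁺ : Star Jump as bs → ⟦ reachableT ⟧ (L ∷ ls ∷ lt ∷ []) ≡ true
    reachableT⁺ jumps = trans reachableT-correct (saturate⁺ ls∈ lt∈ (gmap (map (column cs)) step jumps))
      where
      step : ∀ {a b} → Jump a b → Step (map (column cs) a) (map (column cs) b)
      step {a} {b} (len , cov , w , b⊆) = move⁺ (⊆L w) sub , node⁺ b len cov
        where
        sub : ∀ {x} → x ∈ map (column cs) b → x ∈ map (column cs) (w ∷ a)
        sub x∈ with ∈-map⁻ (column cs) x∈
        ... | u , u∈ , refl = ∈-map⁺ (column cs) (b⊆ u∈)

-- The size of the core

unique-⊆⇒length-≤ : ∀ {A : Set} {xs ys : List A} → Unique xs → (∀ {x} → x ∈ xs → x ∈ ys) →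
                    length xs ≤ length ys
unique-⊆⇒length-≤ []                 xs⊆ys = z≤n
unique-⊆⇒length-≤ {xs = x ∷ xs} (x∉ ∷ u) xs⊆ys with ∈-∃++ (xs⊆ys (here refl))
... | as , bs , refl = ≤-trans (s≤s (unique-⊆⇒length-≤ u xs⊆))
        (≤-reflexive (trans (cong suc (length-++ as))
            (trans (sym (+-suc (length as) (length bs))) (sym (length-++ as)))))
  where
  xs⊆ : ∀ {y} → y ∈ xs → y ∈ as ++ bs
  xs⊆ y∈ with ∈-++⁻ as (xs⊆ys (there y∈))
  ... | inj₁ y∈as         = ∈-++⁺ˡ y∈as
  ... | inj₂ (here refl)  = ⊥-elim (All.lookup x∉ y∈ refl)
  ... | inj₂ (there y∈bs) = ∈-++⁺ʳ as y∈bs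

lookup-injective : ∀ {A : Set} {xs : List A} → Unique xs → ∀ i j → lookup xs i ≡ lookup xs j → i ≡ j
lookup-injective (x∉ ∷ u) zero    zero    eq = refl
lookup-injective (x∉ ∷ u) zero    (suc j) eq = ⊥-elim (All.lookup x∉ (∈-lookup j) eq)
lookup-injective (x∉ ∷ u) (suc i) zero    eq = ⊥-elim (All.lookup x∉ (∈-lookup i) (sym eq))
lookup-injective (x∉ ∷ u) (suc i) (suc j) eq = cong suc (lookup-injective u i j eq)

length-split : ∀ {A : Set} (p : A → Bool) xs →
               length xs ≡ length (filterᵇ p xs) + length (filterᵇ (not ∘ p) xs)
length-split p []       = refl
length-split p (x ∷ xs) with p x
... | true  = cong suc (length-split p xs)
... | false = trans (cong suc (length-split p xs)) (sym (+-suc _ _))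

unique-filterᵇ : ∀ {A : Set} (p : A → Bool) {xs} → Unique xs → Unique (filterᵇ p xs)
unique-filterᵇ p []                     = []
unique-filterᵇ p {x ∷ xs} (x∉ ∷ u) with p x
... | true  = All.tabulate (λ y∈ → All.lookup x∉ (proj₁ (∈-filterᵇ⁻ xs y∈))) ∷ unique-filterᵇ p u
... | false = unique-filterᵇ p u

any-false : ∀ {A : Set} {p : A → Bool} {x} xs → any p xs ≡ false → x ∈ xs → p x ≡ false
any-false {p = p} (y ∷ xs) eq x∈ with p y in py
any-false (y ∷ xs) eq (here refl) | false = py
any-false (y ∷ xs) eq (there x∈)  | false = any-false xs eq x∈

not-true : ∀ {b} → not b ≡ true → b ≡ false
not-true {false} refl = refl

_≢ᵇ_ : ∀ {b} → b ≡ true → b ≢ false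
_≢ᵇ_ {true} _ ()

module Skewness {V : Set} (N : V → V → Bool) (k : ℕ) where
  open Traces N

  -- The vertices kept by the algorithm: each is missed by some (k+1)-tuple
  -- that hits all vertices kept before it.
  data Skew : List V → Set where
    []  : Skew []
    _∷_ : ∀ {v cs} →
          ∃[ ws ] length ws ≡ suc k × hits ws v ≡ false × (∀ {c} → c ∈ cs → hits ws c ≡ true) →
          Skew cs → Skew (v ∷ cs)

  skew-filterᵇ : ∀ p {cs} → Skew cs → Skew (filterᵇ p cs)
  skew-filterᵇ p [] = []
  skew-filterᵇ p {c ∷ cs} ((ws , len , miss , hit) ∷ s) with p c
  ... | true  = (ws , len , miss , λ c∈ → hit (proj₁ (∈-filterᵇ⁻ cs c∈))) ∷ skew-filterᵇ p s
  ... | false = skew-filterᵇ p s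

  -- At a repetition, the tuple of the later occurrence would miss the vertex and also hit it as an
  -- earlier member.
  skew⇒unique : ∀ {cs} → Skew cs → Unique cs
  skew⇒unique [] = []
  skew⇒unique {v ∷ cs} ((ws , _ , miss , hit) ∷ s) =
    ¬Any⇒All¬ cs (λ v∈ → hit v∈ ≢ᵇ miss) ∷ skew⇒unique s

  -- A union bound over the entries of the tuple. The members near the first entry again form a skew
  -- list and number at most `b`; the others must be hit by the remaining entries.
  cover-bound : ∀ b ws {cs} → Skew cs → (∀ {c} → c ∈ cs → hits ws c ≡ true) →
    (∀ {w} → w ∈ ws → ∀ {es} → Skew es → (∀ {e} → e ∈ es → e ∈ cs × N e w ≡ true) → length es ≤ b) →
    length cs ≤ length ws * b
  cover-bound b []       {[]}     s hit small = z≤n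
  cover-bound b []       {c ∷ cs} s hit small with () ← hit (here refl)
  cover-bound b (w ∷ ws) {cs}     s hit small = ≤-trans (≤-reflexive (length-split p cs))
    (+-mono-≤ (small (here refl) (skew-filterᵇ p s) (∈-filterᵇ⁻ cs))
      (cover-bound b ws (skew-filterᵇ (not ∘ p) s) hit′
        (λ w∈ s es⊆ → small (there w∈) s (λ e∈ → proj₁ (∈-filterᵇ⁻ cs (proj₁ (es⊆ e∈))) ,
            proj₂ (es⊆ e∈)))))
    where
    p : V → Bool
    p c = N c w
    hit′ : ∀ {c} → c ∈ filterᵇ (not ∘ p) cs → hits ws c ≡ true
    hit′ {c} c∈ with ∈-filterᵇ⁻ cs c∈
    ... | c∈cs , missed with hit c∈cs
    ... | hit-c rewrite not-true {N c w} missed = hit-c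

-- The last argument counts how many common closed neighbours are still lacking from `d`. If none
-- is, a list longer than `d + d` has at least `d` members outside the set of common neighbours, and
-- only there does closed adjacency mean adjacency. Otherwise the latest vertex counts 1, and each
-- of the `suc k` entries of its tuple accounts for at most `coreBound d k j` earlier ones.
coreBound : ℕ → ℕ → ℕ → ℕ
coreBound d k zero    = d + d
coreBound d k (suc j) = suc (suc k * coreBound d k j)

module Biclique (G : Graph) where
  open Graph G

  closed : Vertex → Vertex → Bool
  closed c w = if does (c ≟ᶠ w) then true else adjacent c w

  closed-adjacent : ∀ {c w} → c ≢ w → closed c w ≡ true → c ~ w
  closed-adjacent {c} {w} c≢w eq rewrite dec-false (c ≟ᶠ w) c≢w = eq

  biclique : ∀ {d} (S A : List Vertex) → Unique S → Unique A → d ≤ length S → d ≤ length A →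
    (∀ {a s} → a ∈ A → s ∈ S → a ≢ s × a ~ s) → completeBipartite d d IsSubgraphOf G
  biclique {d} S A uS uA lenS lenA joined = f ∘ splitAt d , injective , edges
    where
    f : Fin d ⊎ Fin d → Vertex
    f (inj₁ i) = lookup S (inject≤ i lenS)
    f (inj₂ i) = lookup A (inject≤ i lenA)

    across : ∀ i j → f (inj₂ j) ≢ f (inj₁ i) × f (inj₂ j) ~ f (inj₁ i)
    across i j = joined (∈-lookup (inject≤ j lenA)) (∈-lookup (inject≤ i lenS))

    f-injective : ∀ s t → f s ≡ f t → s ≡ t
    f-injective (inj₁ i) (inj₁ j) eq = cong inj₁
        (inject≤-injective lenS lenS i j (lookup-injective uS _ _ eq))
    f-injective (inj₁ i) (inj₂ j) eq = ⊥-elim (proj₁ (across i j) (sym eq))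
    f-injective (inj₂ i) (inj₁ j) eq = ⊥-elim (proj₁ (across j i) eq)
    f-injective (inj₂ i) (inj₂ j) eq = cong inj₂
        (inject≤-injective lenA lenA i j (lookup-injective uA _ _ eq))

    splitAt-injective : ∀ {u v} → splitAt d {d} u ≡ splitAt d v → u ≡ v
    splitAt-injective {u} {v} eq with splitAt d u in equ | splitAt d v in eqv | eq
    ... | inj₁ i | inj₁ _ | refl = trans (sym (splitAt⁻¹-↑ˡ equ)) (splitAt⁻¹-↑ˡ eqv)
    ... | inj₂ i | inj₂ _ | refl = trans (sym (splitAt⁻¹-↑ʳ {d} equ)) (splitAt⁻¹-↑ʳ {d} eqv)

    injective : ∀ {u v} → f (splitAt d u) ≡ f (splitAt d v) → u ≡ v
    injective {u} {v} eq = splitAt-injective (f-injective (splitAt d u) (splitAt d v) eq)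

    edges : ∀ u v → acrossSides (splitAt d u) (splitAt d v) ≡ true → f (splitAt d u) ~ f (splitAt d v)
    edges u v e with splitAt d u | splitAt d v
    ... | inj₁ i | inj₂ j = trans (symmetric _ _) (proj₂ (across i j))
    ... | inj₂ i | inj₁ j = proj₂ (across j i)

  module _ (d k : ℕ) (excludes : ¬ (completeBipartite d d IsSubgraphOf G)) where
    open Skewness closed k
    open import Data.List.Membership.DecPropositional (_≟ᶠ_ {order}) using (_∈?_)

    -- A tuple missing v avoids the common neighbours S of v and cs, so
    -- among the vertices it hits, those near a fixed entry have one more
    -- common neighbour.
    skew-bound : ∀ j {S cs} → Skew cs → Unique S → length S + j ≡ d →
      (∀ {c s} → c ∈ cs → s ∈ S → closed c s ≡ true) → length cs ≤ coreBound d k j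
    skew-bound zero {S} {cs} skew uS len full with length cs ≤? d + d
    ... | yes le = le
    ... | no  gt = ⊥-elim (excludes (biclique S A uS (unique-filterᵇ outside uC)
                     (≤-reflexive (sym lenS)) lenA joined))
      where
      uC = skew⇒unique skew
      outside inside : Vertex → Bool
      inside c = does (c ∈? S)
      outside = not ∘ inside
      A = filterᵇ outside cs
      lenS : length S ≡ d
      lenS = trans (sym (+-identityʳ (length S))) len
      inside⇒∈ : ∀ {c} → inside c ≡ true → c ∈ S
      inside⇒∈ {c} eq with c ∈? S
      ... | yes c∈ = c∈
      outside⇒∉ : ∀ {c} → outside c ≡ true → c ∉ S
      outside⇒∉ {c} eq with c ∈? S
      ... | no c∉ = c∉
      few : length (filterᵇ inside cs) ≤ d
      few = ≤-trans (unique-⊆⇒length-≤ (unique-filterᵇ inside uC)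
              (λ c∈ → inside⇒∈ (proj₂ (∈-filterᵇ⁻ cs c∈)))) (≤-reflexive lenS)
      lenA : d ≤ length A
      lenA = +-cancelˡ-≤ d _ _ (≤-trans (<⇒≤ (≰⇒> gt))
               (≤-trans (≤-reflexive (length-split inside cs)) (+-mono-≤ few ≤-refl)))
      joined : ∀ {a s} → a ∈ A → s ∈ S → a ≢ s × a ~ s
      joined a∈ s∈ with ∈-filterᵇ⁻ cs a∈
      ... | a∈cs , out = a≢s , closed-adjacent a≢s (full a∈cs s∈)
        where a≢s : _ ≢ _
              a≢s refl = outside⇒∉ out s∈
    skew-bound (suc j) []  uS len full = z≤n
    skew-bound (suc j) {S} {v ∷ cs} ((ws , lenws , miss , hit) ∷ skew) uS len full =
      s≤s (≤-trans (cover-bound (coreBound d k j) ws skew hit smaller)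
                   (≤-reflexive (cong (_* coreBound d k j) lenws)))
      where
      smaller : ∀ {w} → w ∈ ws → ∀ {es} → Skew es → (∀ {e} → e ∈ es → e ∈ cs × closed e w ≡ true) →
                length es ≤ coreBound d k j
      smaller {w} w∈ s es⊆ = skew-bound j {w ∷ S} s (¬Any⇒All¬ S w∉S ∷ uS)
        (trans (sym (+-suc (length S) j)) len)
        λ { e∈ (here refl) → proj₂ (es⊆ e∈) ; e∈ (there s∈) → full (there (proj₁ (es⊆ e∈))) s∈ }
        where
        w∉S : w ∉ S
        w∉S w∈S = full (here refl) w∈S ≢ᵇ any-false ws miss w∈

-- Reconfiguration sequences and jumps

Δ-self : ∀ {n} (A : Subset n) → ∣ A Δ A ∣ ≡ 0
Δ-self []          = refl
Δ-self (true ∷ A)  = Δ-self A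
Δ-self (false ∷ A) = Δ-self A

∣insert∣ : ∀ {n} (A : Subset n) x → Vec.lookup A x ≡ false → ∣ A [ x ]≔ true ∣ ≡ suc ∣ A ∣
∣insert∣ (false ∷ A) zero    refl = refl
∣insert∣ (true ∷ A)  (suc x) eq   = cong suc (∣insert∣ A x eq)
∣insert∣ (false ∷ A) (suc x) eq   = ∣insert∣ A x eq

Δ-insert : ∀ {n} (A : Subset n) x → Vec.lookup A x ≡ false → ∣ A Δ (A [ x ]≔ true) ∣ ≡ 1
Δ-insert (false ∷ A) zero    refl = cong suc (Δ-self A)
Δ-insert (true ∷ A)  (suc x) eq   = Δ-insert A x eq
Δ-insert (false ∷ A) (suc x) eq   = Δ-insert A x eq

Δ-remove : ∀ {n} (A : Subset n) x → Vec.lookup A x ≡ false → ∣ (A [ x ]≔ true) Δ A ∣ ≡ 1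
Δ-remove (false ∷ A) zero    refl = cong suc (Δ-self A)
Δ-remove (true ∷ A)  (suc x) eq   = Δ-remove A x eq
Δ-remove (false ∷ A) (suc x) eq   = Δ-remove A x eq

Δ-empty : ∀ {n} (A B : Subset n) → ∣ A Δ B ∣ ≡ 0 → A ≡ B
Δ-empty []          []          eq = refl
Δ-empty (true ∷ A)  (true ∷ B)  eq = cong (true ∷_) (Δ-empty A B eq)
Δ-empty (false ∷ A) (false ∷ B) eq = cong (false ∷_) (Δ-empty A B eq)
Δ-empty (true ∷ A)  (false ∷ B) ()
Δ-empty (false ∷ A) (true ∷ B)  ()

_Inserts_Into_ : ∀ {n} → Subset n → Fin n → Subset n → Set
B Inserts x Into A = Vec.lookup A x ≡ false × B ≡ A [ x ]≔ true

Δ-singleton : ∀ {n} (A B : Subset n) → ∣ A Δ B ∣ ≡ 1 →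
              ∃[ x ] (B Inserts x Into A ⊎ A Inserts x Into B)
Δ-singleton []          []          ()
Δ-singleton (true ∷ A)  (false ∷ B) eq = zero , inj₂
    (refl , cong (true ∷_) (Δ-empty A B (suc-injective eq)))
Δ-singleton (false ∷ A) (true ∷ B)  eq = zero , inj₁
    (refl , cong (true ∷_) (sym (Δ-empty A B (suc-injective eq))))
Δ-singleton (true ∷ A)  (true ∷ B)  eq with Δ-singleton A B eq
... | x , inj₁ (out , refl) = suc x , inj₁ (out , refl)
... | x , inj₂ (out , refl) = suc x , inj₂ (out , refl)
Δ-singleton (false ∷ A) (false ∷ B) eq with Δ-singleton A B eq
... | x , inj₁ (out , refl) = suc x , inj₁ (out , refl)
... | x , inj₂ (out , refl) = suc x , inj₂ (out , refl)

∈-insert⁻ : ∀ {n} (A : Subset n) {x y} → y ∈ˢ A [ x ]≔ true → y ≡ x ⊎ y ∈ˢ A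
∈-insert⁻ A {x} {y} y∈ with y ≟ᶠ x
... | yes y≡x = inj₁ y≡x
... | no  y≢x = inj₂ (lookup⇒[]= y A (trans (sym (lookup∘update′ y≢x A true)) ([]=⇒lookup y∈)))

∈-insert⁺ : ∀ {n} (A : Subset n) {x y} → y ≡ x ⊎ y ∈ˢ A → y ∈ˢ A [ x ]≔ true
∈-insert⁺ A {x} (inj₁ refl) = lookup⇒[]= x _ (lookup∘update x A true)
∈-insert⁺ A {x} {y} (inj₂ y∈) with y ≟ᶠ x
... | yes refl = lookup⇒[]= x _ (lookup∘update x A true)
... | no  y≢x  = lookup⇒[]= y _ (trans (lookup∘update′ y≢x A true) ([]=⇒lookup y∈))

∉ˢ⇒false : ∀ {n} (A : Subset n) {x} → ¬ (x ∈ˢ A) → Vec.lookup A x ≡ false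
∉ˢ⇒false A {x} x∉ with Vec.lookup A x in eq
... | true  = ⊥-elim (x∉ (lookup⇒[]= x A eq))
... | false = refl

elements : ∀ {n} → Subset n → List (Fin n)
elements D = filterᵇ (Vec.lookup D) (allFin _)

∈-elements⁺ : ∀ {n} {D : Subset n} {x} → x ∈ˢ D → x ∈ elements D
∈-elements⁺ {x = x} x∈ = ∈-filterᵇ⁺ (∈-allFin x) ([]=⇒lookup x∈)

∈-elements⁻ : ∀ {n} {D : Subset n} {x} → x ∈ elements D → x ∈ˢ D
∈-elements⁻ {D = D} {x} x∈ = lookup⇒[]= x D (proj₂ (∈-filterᵇ⁻ (allFin _) x∈))

length-elements : ∀ {n} (D : Subset n) → length (elements D) ≡ ∣ D ∣
length-elements D = go D (Vec.lookup D) (λ i → i) (λ _ → refl)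
  where
  go : ∀ {m} {A : Set} (D : Subset m) (p : A → Bool) (f : Fin m → A) →
       (∀ i → p (f i) ≡ Vec.lookup D i) → length (filterᵇ p (tabulate f)) ≡ ∣ D ∣
  go []          p f eq = refl
  go (true ∷ D)  p f eq rewrite eq zero = cong suc (go D p (f ∘ suc) (eq ∘ suc))
  go (false ∷ D) p f eq rewrite eq zero = go D p (f ∘ suc) (eq ∘ suc)

unique-elements : ∀ {n} (D : Subset n) → Unique (elements D)
unique-elements D = unique-filterᵇ (Vec.lookup D) (allFin⁺ _)

⊆-size⇒≡ : ∀ {n} {A B : Subset n} → A ⊆ˢ B → ∣ B ∣ ≤ ∣ A ∣ → B ≡ A
⊆-size⇒≡ {A = A} {B} A⊆B size = ⊆-antisym B⊆A A⊆B
  where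
  B⊆A : B ⊆ˢ A
  B⊆A {x} x∈B with x ∈ˢ? A
  ... | yes x∈A = x∈A
  ... | no  x∉A = ⊥-elim (<-irrefl refl (≤-trans (p⊂q⇒∣p∣<∣q∣ (A⊆B , x , x∈B , x∉A)) size))

module Reconfiguration (G : Graph) (k : ℕ) (cs : List (Graph.Vertex G)) where
  open Graph G
  open Biclique G using (closed)
  open Traces closed
  open Jumps closed cs k
  open import Data.List.Membership.DecPropositional (_≟ᶠ_ {order}) using (_∈?_)

  hits⇒ : ∀ {ws v} → hits ws v ≡ true → ∃[ w ] w ∈ ws × (v ≡ w ⊎ v ~ w)
  hits⇒ {ws} {v} eq with any-true⁻ ws eq
  ... | w , w∈ , eq′ with v ≟ᶠ w
  ... | yes v≡w = w , w∈ , inj₁ v≡w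
  ... | no  _   = w , w∈ , inj₂ eq′

  ⇒hits : ∀ {ws v w} → w ∈ ws → v ≡ w ⊎ v ~ w → hits ws v ≡ true
  ⇒hits {v = v} {w} w∈ near = any-true⁺ w∈ (closed-true near)
    where
    closed-true : v ≡ w ⊎ v ~ w → closed v w ≡ true
    closed-true near with v ≟ᶠ w | near
    ... | yes _   | _        = refl
    ... | no  v≢w | inj₁ v≡w = ⊥-elim (v≢w v≡w)
    ... | no  _   | inj₂ v~w = v~w

  hits⇒dominating : ∀ {ws D} → (∀ {w} → w ∈ ws → w ∈ˢ D) → (∀ v → hits ws v ≡ true) → Dominating G D
  hits⇒dominating ws⊆D hit v with hits⇒ (hit v)
  ... | w , w∈ , inj₁ refl = inj₁ (ws⊆D w∈)
  ... | w , w∈ , inj₂ v~w  = inj₂ (w , ws⊆D w∈ , v~w)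

  dominating⇒covers : ∀ {ws D} → Dominating G D → (∀ {w} → w ∈ˢ D → w ∈ ws) → Covers ws
  dominating⇒covers dom D⊆ws {c} _ with dom c
  ... | inj₁ c∈D            = ⇒hits (D⊆ws c∈D) (inj₁ refl)
  ... | inj₂ (u , u∈D , c~u) = ⇒hits (D⊆ws u∈D) (inj₂ c~u)

  elements-jump : ∀ {A a} → Dominating G A → ∣ A ∣ ≡ suc k →
                  ∃[ w ] (∀ {x} → x ∈ˢ A → x ∈ w ∷ a) → Jump a (elements A)
  elements-jump {A} dom size (w , A⊆) =
    trans (length-elements A) size , dominating⇒covers {elements A} dom ∈-elements⁺ ,
        w , A⊆ ∘ ∈-elements⁻

  -- The tuple lags behind the set: `A` lies in `a` together with one spare vertex `w`. Before an
  -- insertion `A` has the smaller size, so a jump to `elements A` is possible and the inserted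
  -- vertex becomes the new spare. A removal only shrinks `A` and leaves the tuple as it is. One
  -- last jump arrives at `elements B`.
  reachable⇒jumps : ∀ {A B a} → Dominating G B → ∣ B ∣ ≡ suc k → Reachable G (suc k) A B →
    ∃[ w ] (∀ {x} → x ∈ˢ A → x ∈ w ∷ a) → Star Jump a (elements B)
  reachable⇒jumps domB sizeB ε A⊆ = elements-jump domB sizeB A⊆ ◅ ε
  reachable⇒jumps {A} domB sizeB (_◅_ {j = A′} ((domA , sizeA) , (_ , sizeA′) , diff) path) (w , A⊆)
    with Δ-singleton A A′ diff | sizeA
  ... | x , inj₁ (_ , refl) | inj₁ sizeA = elements-jump domA sizeA (w , A⊆) ◅
    reachable⇒jumps domB sizeB path (x , insert)
    where
    insert : ∀ {y} → y ∈ˢ A [ x ]≔ true → y ∈ x ∷ elements A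
    insert y∈ with ∈-insert⁻ A y∈
    ... | inj₁ refl = here refl
    ... | inj₂ y∈A  = there (∈-elements⁺ y∈A)
  -- Inserting into a node of the larger size would leave the admissible sizes.
  ... | x , inj₁ (out , refl) | inj₂ sizeA = ⊥-elim (too-big sizeA′)
    where
    too-big : ∣ A [ x ]≔ true ∣ ≡ suc k ⊎ ∣ A [ x ]≔ true ∣ ≡ suc (suc k) → ⊥
    too-big size rewrite ∣insert∣ A x out | sizeA with size
    ... | inj₁ ()
    ... | inj₂ ()
  ... | x , inj₂ (out , refl) | _ =
    reachable⇒jumps domB sizeB path (w , A⊆ ∘ ∈-insert⁺ A′ ∘ inj₂)

  module _ (core : ∀ a → length a ≡ suc k → Covers a → ∀ v → hits a v ≡ true) where

    -- The set `A` contains the tuple, and its surplus tokens wait anywhere. If the vertex of a jump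
    -- is already in `A`, or does not occur in `b`, then `b` lies in `A` as well and no token moves.
    jumps⇒reachable : ∀ {a A B} → ∣ B ∣ ≡ suc k → Star Jump a (elements B) →
      ∣ A ∣ ≡ suc k → (∀ {x} → x ∈ a → x ∈ˢ A) → (∀ v → hits a v ≡ true) → Reachable G (suc k) A B
    -- At the end `elements B` lies in `A` and is equally large, so no token is left waiting
    -- elsewhere.
    jumps⇒reachable {B = B} sizeB ε sizeA a⊆A hit =
      subst (λ S → Reachable G (suc k) S B)
        (sym (⊆-size⇒≡ (a⊆A ∘ ∈-elements⁺) (≤-reflexive (trans sizeA (sym sizeB))))) ε
    jumps⇒reachable {a} {A} sizeB (_◅_ {j = b} (len , cov , w , b⊆) path) sizeA a⊆A hit
      with w ∈ˢ? A | w ∈? b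
    ... | yes w∈A | _ = jumps⇒reachable sizeB path sizeA
          (λ x∈ → stay (b⊆ x∈)) (core b len cov)
      where
      stay : ∀ {x} → x ∈ w ∷ a → x ∈ˢ A
      stay (here refl) = w∈A
      stay (there x∈)  = a⊆A x∈
    ... | no _ | no w∉b = jumps⇒reachable sizeB path sizeA
          (λ x∈ → stay x∈ (b⊆ x∈)) (core b len cov)
      where
      stay : ∀ {x} → x ∈ b → x ∈ w ∷ a → x ∈ˢ A
      stay x∈b (here refl) = ⊥-elim (w∉b x∈b)
      stay x∈b (there x∈)  = a⊆A x∈
    -- Here `b` has as many entries as `A` has members and spends one on `w`, so by counting some
    -- `x` of `A` does not occur in `b`. Adding `w` before removing `x` gives two edges; each set on
    -- the way contains `a` or `b` and therefore dominates.
    ... | no w∉A | yes w∈b with All.all? (_∈? b) (elements A)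
    ...   | yes A⊆b = ⊥-elim
        (<-irrefl refl (≤-trans (≤-reflexive (cong suc (sym (trans (length-elements A) sizeA))))
              (≤-trans (unique-⊆⇒length-≤ unique wA⊆b) (≤-reflexive len))))
      where
      unique : Unique (w ∷ elements A)
      unique = ¬Any⇒All¬ (elements A) (w∉A ∘ ∈-elements⁻) ∷ unique-elements A
      wA⊆b : ∀ {x} → x ∈ w ∷ elements A → x ∈ b
      wA⊆b (here refl) = w∈b
      wA⊆b (there x∈)  = All.lookup A⊆b x∈
    ...   | no A⊈b with find (¬All⇒Any¬ (_∈? b) (elements A) A⊈b)
    ...     | x , x∈A , x∉b =
      ((domA , inj₁ sizeA) , (domA₁ , inj₂ sizeA₁) , Δ-insert A w w-out) ◅
      ((domA₁ , inj₂ sizeA₁) , (domA₂ , inj₁ sizeA₂) , subst (λ S → ∣ S Δ A₂ ∣ ≡ 1) back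
          (Δ-remove A₂ x x-out)) ◅
      jumps⇒reachable sizeB path sizeA₂ b⊆A₂ (core b len cov)
      where
      w-out : Vec.lookup A w ≡ false
      w-out = ∉ˢ⇒false A w∉A
      A₁ A₂ : Subset order
      A₁ = A [ w ]≔ true
      A₂ = A₁ [ x ]≔ false
      x-out : Vec.lookup A₂ x ≡ false
      x-out = lookup∘update x A₁ false
      x∈A₁ : Vec.lookup A₁ x ≡ true
      x∈A₁ = []=⇒lookup (∈-insert⁺ A (inj₂ (∈-elements⁻ x∈A)))
      back : A₂ [ x ]≔ true ≡ A₁
      back = trans ([]≔-idempotent A₁ x) (trans (cong (A₁ [ x ]≔_) (sym x∈A₁)) ([]≔-lookup A₁ x))
      b⊆A₂ : ∀ {y} → y ∈ b → y ∈ˢ A₂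
      b⊆A₂ {y} y∈ with y ≟ᶠ x
      ... | yes refl = ⊥-elim (x∉b y∈)
      ... | no  y≢x  = lookup⇒[]= y A₂
          (trans (lookup∘update′ y≢x A₁ false) ([]=⇒lookup (∈-insert⁺ A (choose (b⊆ y∈)))))
        where
        choose : y ∈ w ∷ a → y ≡ w ⊎ y ∈ˢ A
        choose (here eq)  = inj₁ eq
        choose (there y∈) = inj₂ (a⊆A y∈)
      domA  = hits⇒dominating a⊆A hit
      domA₁ = hits⇒dominating (∈-insert⁺ A ∘ inj₂ ∘ a⊆A) hit
      domA₂ = hits⇒dominating b⊆A₂ (core b len cov)
      sizeA₁ : ∣ A₁ ∣ ≡ suc (suc k)
      sizeA₁ = trans (∣insert∣ A w w-out) (cong suc sizeA)
      sizeA₂ : ∣ A₂ ∣ ≡ suc k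
      sizeA₂ = suc-injective (trans (sym (∣insert∣ A₂ x x-out)) (trans (cong ∣_∣ back) sizeA₁))

-- The decision procedure

nat subset matrix : Ty
nat    = list bool
subset = list bool
matrix = list (list bool)

identityStepT : Tm (trace ∷ matrix ∷ matrix ∷ []) matrix
identityStepT = (bit true ▹ mapT v1 (bit false)) ▹ mapT v1 (bit false ▹ v0)

-- Vertices carry no names in the encoding, so equality of vertices is supplied as a matrix, grown
-- by one row and one column for each row of the input.
identityT : Tm (matrix ∷ []) matrix
identityT = fold v0 empty identityStepT

closedRowT : Tm ((trace ⊗ trace) ∷ matrix ∷ matrix ∷ []) trace
closedRowT = mapT (zipT (fst v0) (snd v0)) (ite (fst v0) (bit true) (snd v0))

closedT : Tm (matrix ∷ matrix ∷ []) matrix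
closedT = mapT (zipT v0 v1) closedRowT

extendT : Tm (trace ∷ list trace ∷ matrix ∷ nat ∷ []) (list trace)
extendT = mapT (zipT v0 v1) (fst v0 ▹ snd v0)

-- The test sees the extended traces without duplicates, but the loop passes on the full list: its
-- entries must stay aligned with the vertices, because the next row is zipped to it.
coreStepT : Tm (trace ∷ list trace ∷ matrix ∷ nat ∷ []) (list trace)
coreStepT = bind extendT (bind (app dedupT (i0 ∷ [])) (ite (app missesT (i0 ∷ i5 ∷ [])) v1 v3))

tracesT : Tm (matrix ∷ nat ∷ []) (list trace)
tracesT = fold v0 (mapT v0 empty) coreStepT

selectT : Tm (subset ∷ list trace ∷ []) (list trace)
selectT = mapT (filterT (zipT v0 v1) (fst v0)) (snd v0)

opaque
  decideT : Tm (matrix ∷ nat ∷ subset ∷ subset ∷ []) bool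
  decideT =
    bind (app identityT (i0 ∷ []))
    (bind (app closedT (i0 ∷ i1 ∷ []))
    (bind (app tracesT (i0 ∷ i3 ∷ []))
    (bind (app selectT (i5 ∷ i0 ∷ []))
    (bind (app selectT (there i6 ∷ i1 ∷ []))
    (bind (app dedupT (i2 ∷ []))
    (app reachableT (i0 ∷ i2 ∷ i1 ∷ [])))))))

input : Ty
input = (matrix ⊗ nat ⊗ nat ⊗ subset ⊗ subset) ⊗ nat

mainT : Tm (input ∷ []) bool
mainT =
  bind (fst v0)
  (bind (fst v0)
  (bind (snd v1)
  (bind (snd v0)
  (bind (fst v0)
  (bind (snd v1)
  (bind (fst v0)
  (bind (snd v1)
  (app decideT (i6 ∷ i3 ∷ i1 ∷ i0 ∷ [])))))))))

-- Correctness of the decision procedure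

identity : ∀ n → List (List Bool)
identity n = tabulate {n = n} (λ u → tabulate (λ v → does (u ≟ᶠ v)))

identityStepT-correct : ∀ n xs M → ⟦ identityStepT ⟧ (xs ∷ identity n ∷ M ∷ []) ≡ identity (suc n)
identityStepT-correct n xs M = cong₂ (λ r R → (true ∷ r) ∷ R)
  (trans (mapT-correct v1 (bit false) ρ) (map-tabulate row (λ _ → false)))
  (trans (mapT-correct v1 (bit false ▹ v0) ρ) (map-tabulate row (false ∷_)))
  where
  ρ : Env (trace ∷ matrix ∷ matrix ∷ [])
  ρ = xs ∷ identity n ∷ M ∷ []
  row : Fin n → List Bool
  row u = tabulate (λ v → does (u ≟ᶠ v))

identityT-correct : ∀ M → ⟦ identityT ⟧ (M ∷ []) ≡ identity (length M)
identityT-correct M = trans (go M 0) (cong identity (+-identityʳ (length M)))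
  where
  go : ∀ xs i → foldl (λ a x → ⟦ identityStepT ⟧ (x ∷ a ∷ M ∷ [])) (identity i) xs
      ≡ identity (length xs + i)
  go []       i = refl
  go (x ∷ xs) i rewrite identityStepT-correct i x M = trans (go xs (suc i))
      (cong identity (+-suc (length xs) i))

zip-map : ∀ {A B C : Set} (f : A → B) (g : A → C) xs → zip (map f xs) (map g xs)
    ≡ map (λ x → f x , g x) xs
zip-map f g []       = refl
zip-map f g (x ∷ xs) = cong (_ ∷_) (zip-map f g xs)

filterᵇ-map : ∀ {A B : Set} (p : B → Bool) (f : A → B) xs → filterᵇ p (map f xs)
    ≡ map f (filterᵇ (p ∘ f) xs)
filterᵇ-map p f []       = refl
filterᵇ-map p f (x ∷ xs) with p (f x)
... | true  = cong (f x ∷_) (filterᵇ-map p f xs)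
... | false = filterᵇ-map p f xs

mapT-zipT : ∀ {Γ σ τ υ} {A : Set} (e : Tm Γ (list σ)) (e′ : Tm Γ (list τ)) (f : Tm ((σ ⊗ τ) ∷ Γ) υ) ρ
  (g : A → Val σ) (h : A → Val τ) xs → ⟦ e ⟧ ρ ≡ map g xs → ⟦ e′ ⟧ ρ ≡ map h xs →
  ⟦ mapT (zipT e e′) f ⟧ ρ ≡ map (λ x → ⟦ f ⟧ ((g x , h x) ∷ ρ)) xs
mapT-zipT e e′ f ρ g h xs eq eq′ =
  trans (mapT-correct (zipT e e′) f ρ)
  (trans (cong (map (λ x → ⟦ f ⟧ (x ∷ ρ)))
      (trans (zipT-correct e e′ ρ) (trans (cong₂ zip eq eq′) (zip-map g h xs))))
  (sym (map-∘ xs)))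

selectT-correct : ∀ {n} (D : Subset n) (col : Fin n → List Bool) →
  ⟦ selectT ⟧ (map (Vec.lookup D) (allFin n) ∷ map col (allFin n) ∷ []) ≡ map col (elements D)
selectT-correct {n} D col =
  trans (mapT-correct (filterT (zipT v0 v1) (fst v0)) (snd v0) ρ)
  (trans (cong (map proj₂) (trans (filterT-correct (zipT v0 v1) (fst v0) ρ)
    (trans (cong (filterᵇ proj₁) (trans (zipT-correct v0 v1 ρ) (zip-map (Vec.lookup D) col (allFin n))))
      (filterᵇ-map proj₁ (λ x → Vec.lookup D x , col x) (allFin n)))))
  (sym (map-∘ (elements D))))
  where
  ρ : Env (subset ∷ list trace ∷ [])
  ρ = map (Vec.lookup D) (allFin n) ∷ map col (allFin n) ∷ []

module Correctness (G : Graph) where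
  open Graph G
  open Biclique G using (closed)
  open Traces closed

  vertices : List Vertex
  vertices = allFin order

  rows : (Vertex → Vertex → Bool) → List (List Bool)
  rows r = map (λ u → map (r u) vertices) vertices

  columns : List Vertex → List (List Bool)
  columns cs = map (column cs) vertices

  ∈-columns⁻ : ∀ cs {x} → x ∈ dedup (columns cs) → ∃[ w ] x ≡ column cs w
  ∈-columns⁻ cs x∈ with ∈-map⁻ (column cs) (∈-dedup⁻ (columns cs) x∈)
  ... | w , _ , eq = w , eq

  ∈-columns⁺ : ∀ cs w → column cs w ∈ dedup (columns cs)
  ∈-columns⁺ cs w = ∈-dedup⁺ (∈-map⁺ (column cs) (∈-allFin w))

  length-rows : ∀ r → length (rows r) ≡ order
  length-rows r = trans (length-map _ vertices) (length-tabulate (λ i → i))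

  identityT-rows : ⟦ identityT ⟧ (rows adjacent ∷ []) ≡ rows (λ u v → does (u ≟ᶠ v))
  identityT-rows = trans (identityT-correct (rows adjacent))
      (trans (cong identity (length-rows adjacent))
    (sym (trans (map-tabulate (λ i → i) (λ u → map (λ v → does (u ≟ᶠ v)) vertices))
      (tabulate-cong (λ u → map-tabulate (λ i → i) (λ v → does (u ≟ᶠ v)))))))

  closedT-correct : ⟦ closedT ⟧ (rows (λ u v → does (u ≟ᶠ v)) ∷ rows adjacent ∷ []) ≡ rows closed
  closedT-correct =
    trans (mapT-zipT v0 v1 closedRowT ρ (λ u → map (λ v → does (u ≟ᶠ v)) vertices)
        (λ u → map (adjacent u) vertices) vertices refl refl)
    (map-cong (λ u → mapT-zipT (fst v0) (snd v0) (ite (fst v0) (bit true) (snd v0))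
       ((map (λ v → does (u ≟ᶠ v)) vertices , map (adjacent u) vertices) ∷ ρ)
       (λ v → does (u ≟ᶠ v)) (adjacent u) vertices refl refl) vertices)
    where
    ρ : Env (matrix ∷ matrix ∷ [])
    ρ = rows (λ u v → does (u ≟ᶠ v)) ∷ rows adjacent ∷ []

  extendT-correct : ∀ v cs N ks →
    ⟦ extendT ⟧ (map (closed v) vertices ∷ columns cs ∷ N ∷ ks ∷ []) ≡ columns (v ∷ cs)
  extendT-correct v cs N ks = mapT-zipT v0 v1 (fst v0 ▹ snd v0)
    (map (closed v) vertices ∷ columns cs ∷ N ∷ ks ∷ []) (closed v) (column cs) vertices refl refl

  module _ (ks : List Bool) where
    private k = length ks
    open Skewness closed k

    record Core (done cs : List Vertex) : Set where
      constructor core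
      field
        skew    : Skew cs
        sufficient : ∀ ws → length ws ≡ suc k → (∀ {c} → c ∈ cs → hits ws c ≡ true) →
                     ∀ {v} → v ∈ done → hits ws v ≡ true

    -- Each outcome of the test preserves `Core`. A tuple that misses `v` and hits the core extends
    -- `skew`; if there is none, hitting the old core already forces hitting `v`, which extends
    -- `sufficient`.
    coreStepT-correct : ∀ {done cs} v N → Core done cs →
      ∃[ cs′ ] ⟦ coreStepT ⟧ (map (closed v) vertices ∷ columns cs ∷ N ∷ ks ∷ [])
          ≡ columns cs′ × Core (v ∷ done) cs′
    coreStepT-correct {done} {cs} v N (core skew suff)
      rewrite extendT-correct v cs N ks
      with ⟦ missesT ⟧ (dedup (columns (v ∷ cs)) ∷ ks ∷ []) in eq
    ... | true with missesT⁻ v cs (dedup (columns (v ∷ cs))) (∈-columns⁻ (v ∷ cs))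
        (∈-columns⁺ (v ∷ cs)) ks eq
    ...   | ws , len , miss , hit = v ∷ cs , refl ,
      core ((ws , trans len (+-comm k 1) , miss , hit) ∷ skew)
        λ { ws len hit (here refl) → hit (here refl) ; ws len hit (there v∈) →
            suff ws len (hit ∘ there) v∈ }
    coreStepT-correct {done} {cs} v N (core skew suff) | false = cs , refl ,
      core skew λ { ws len hit (here refl) → forced ws len hit ; ws len hit (there v∈) →
          suff ws len hit v∈ }
      where
      forced : ∀ ws → length ws ≡ suc k → (∀ {c} → c ∈ cs → hits ws c ≡ true) → hits ws v ≡ true
      forced ws len hit with hits ws v in miss
      ... | true = refl
      ... | false with () ← trans (sym eq) (missesT⁺ v cs (dedup (columns (v ∷ cs)))
                    (∈-columns⁻ (v ∷ cs)) (∈-columns⁺ (v ∷ cs)) ks ws (trans len (+-comm 1 k)) miss hit)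

    tracesT-start : ⟦ mapT v0 empty ⟧ (rows closed ∷ ks ∷ []) ≡ columns []
    tracesT-start = trans (mapT-correct {τ = trace} v0 empty (rows closed ∷ ks ∷ []))
        (sym (map-∘ vertices))

    tracesT-correct : ∃[ cs ] ⟦ tracesT ⟧ (rows closed ∷ ks ∷ []) ≡ columns cs × Core vertices cs
    tracesT-correct with go vertices [] [] (core [] (λ _ _ _ ()))
      where
      go : ∀ vs done cs → Core done cs →
           ∃[ cs′ ] foldl (λ E r → ⟦ coreStepT ⟧ (r ∷ E ∷ rows closed ∷ ks ∷ [])) (columns cs)
               (map (λ u → map (closed u) vertices) vs)
                    ≡ columns cs′ × Skew cs′ ×
                    (∀ ws → length ws ≡ suc k → (∀ {c} → c ∈ cs′ → hits ws c ≡ true) →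
                       ∀ {v} → v ∈ vs ⊎ v ∈ done → hits ws v ≡ true)
      go [] done cs (core skew suff) = cs , refl , skew , λ { ws len hit (inj₂ v∈) → suff ws len hit v∈ }
      go (v ∷ vs) done cs c with coreStepT-correct v (rows closed) c
      ... | cs′ , eq , c′ rewrite eq with go vs (v ∷ done) cs′ c′
      ... | cs″ , eq″ , skew , suff = cs″ , eq″ , skew , λ
        { ws len hit (inj₁ (here refl)) → suff ws len hit (inj₂ (here refl))
        ; ws len hit (inj₁ (there v∈))  → suff ws len hit (inj₁ v∈)
        ; ws len hit (inj₂ v∈)          → suff ws len hit (inj₂ (there v∈)) }
    ... | cs , eq , skew , suff = cs ,
      trans (cong (λ E → foldl (λ E r → ⟦ coreStepT ⟧ (r ∷ E ∷ rows closed ∷ ks ∷ [])) E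
          (rows closed)) tracesT-start) eq ,
      core skew (λ ws len hit v∈ → suff ws len hit (inj₁ v∈))

    decision : Subset order → Subset order → Bool
    decision Ds Dt =
      ⟦ decideT ⟧ (rows adjacent ∷ ks ∷ map (Vec.lookup Ds) vertices ∷ map (Vec.lookup Dt) vertices ∷ [])

    opaque
      unfolding decideT

      decision≡reachableT : ∀ {cs} Ds Dt → ⟦ tracesT ⟧ (rows closed ∷ ks ∷ []) ≡ columns cs →
        decision Ds Dt ≡
        ⟦ reachableT ⟧ (dedup (columns cs) ∷ map (column cs) (elements Ds)
            ∷ map (column cs) (elements Dt) ∷ [])
      decision≡reachableT {cs} Ds Dt eq = trans
        (cong finish (trans (cong (λ N → ⟦ tracesT ⟧ (N ∷ ks ∷ []))
          (trans (cong (λ I → ⟦ closedT ⟧ (I ∷ rows adjacent ∷ [])) identityT-rows)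
              closedT-correct)) eq))
        (cong₂ (λ ls lt → ⟦ reachableT ⟧ (dedup (columns cs) ∷ ls ∷ lt ∷ []))
          (selectT-correct Ds (column cs)) (selectT-correct Dt (column cs)))
        where
        select : Subset order → List (List Bool) → List (List Bool)
        select D E = ⟦ selectT ⟧ (map (Vec.lookup D) vertices ∷ E ∷ [])

        finish : List (List Bool) → Bool
        finish E = ⟦ reachableT ⟧ (dedup E ∷ select Ds E ∷ select Dt E ∷ [])

    decideT-correct : ∀ k′ Ds Dt → k ≡ suc k′ → Dominating G Ds → Dominating G Dt →
      ∣ Ds ∣ ≡ suc k′ → ∣ Dt ∣ ≡ suc k′ →
      (decision Ds Dt ≡ true → Reachable G (suc k′) Ds Dt) ×
          (Reachable G (suc k′) Ds Dt → decision Ds Dt ≡ true)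
    decideT-correct k′ Ds Dt k≡ domS domT sizeS sizeT with tracesT-correct
    ... | cs , eq , core _ suff = yes⇒ , ⇒yes
      where
      open Reconfiguration G k′ cs
      open Jumps closed cs k′

      lengthS = trans (length-elements Ds) sizeS
      lengthT = trans (length-elements Dt) sizeT
      coversS = dominating⇒covers {elements Ds} domS ∈-elements⁺
      coversT = dominating⇒covers {elements Dt} domT ∈-elements⁺

      -- Repeating an entry turns a k-tuple into a (k+1)-tuple.
      enough : ∀ a → length a ≡ suc k′ → Covers a → ∀ v → hits a v ≡ true
      enough (w ∷ ws) len cov v = trans (sym (absorb (closed v w) (hits ws v)))
        (suff (w ∷ w ∷ ws) (trans (cong suc len) (cong suc (sym k≡)))
          (λ {c} c∈ → trans (absorb (closed c w) (hits ws c)) (cov c∈)) (∈-allFin v))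
        where
        absorb : ∀ a b → a ∨ (a ∨ b) ≡ a ∨ b
        absorb true  b = refl
        absorb false b = refl

      yes⇒ : decision Ds Dt ≡ true → Reachable G (suc k′) Ds Dt
      yes⇒ eq′ = jumps⇒reachable enough sizeT
        (reachableT⁻ (dedup (columns cs)) (∈-columns⁻ cs) (∈-columns⁺ cs) lengthS lengthT coversS
            coversT (trans (sym (decision≡reachableT Ds Dt eq)) eq′))
        sizeS ∈-elements⁻ (enough (elements Ds) lengthS coversS)

      ⇒yes : Reachable G (suc k′) Ds Dt → decision Ds Dt ≡ true
      ⇒yes path = trans (decision≡reachableT Ds Dt eq)
        (reachableT⁺ (dedup (columns cs)) (∈-columns⁻ cs) (∈-columns⁺ cs) lengthS lengthT coversS
            coversT jumps)
        where
        jumps : Star Jump (elements Ds) (elements Dt)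
        jumps with elements Ds in eqS
        ... | []     = ⊥-elim (0≢suc (trans (sym (cong length eqS)) lengthS))
          where 0≢suc : 0 ≢ suc k′
                0≢suc ()
        -- Initially the tuple contains the whole set, so any vertex can act as the spare one; the
        -- head of the nonempty tuple is at hand.
        ... | w ∷ ws = reachable⇒jumps domT sizeT path
            (w , λ x∈ → there (subst (_ ∈_) eqS (∈-elements⁺ x∈)))

-- Loop bounds for the decision procedure

module _ (X : ℕ) where

  small-reverseT : ∀ {Γ σ} {e : Tm Γ (list σ)} {ρ} → Small X e ρ → length (⟦ e ⟧ ρ) ≤ X →
                   Small X (reverseT e) ρ
  small-reverseT {e = e} {ρ} Se len = small-fold Se small-empty len
    (small-loop (λ _ → ⊤) (⟦ e ⟧ ρ) (λ _ _ → small-loopFree (v0 ▹ v1) refl , tt) tt)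

  small-foldrT : ∀ {Γ σ τ} {e : Tm Γ (list σ)} {z : Tm Γ τ} {g : Tm (σ ∷ τ ∷ Γ) τ} {ρ} →
    Small X e ρ → Small X z ρ → length (⟦ e ⟧ ρ) ≤ X →
    (∀ {x a} → x ∈ ⟦ e ⟧ ρ → Small X g (x ∷ a ∷ ρ)) → Small X (foldrT e z g) ρ
  small-foldrT {e = e} {ρ = ρ} Se Sz len Sg = small-fold
    (small-reverseT Se len) Sz (≤-trans (≤-reflexive (length-reverse (⟦ e ⟧ ρ))) len)
    (small-loop (λ _ → ⊤) (reverse (⟦ e ⟧ ρ)) (λ x∈ _ → Sg (reverse⁻ x∈) , tt) tt)

  small-mapT : ∀ {Γ σ τ} {e : Tm Γ (list σ)} {f : Tm (σ ∷ Γ) τ} {ρ} → Small X e ρ →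
      length (⟦ e ⟧ ρ) ≤ X →
    (∀ {x} → x ∈ ⟦ e ⟧ ρ → Small X f (x ∷ ρ)) → Small X (mapT e f) ρ
  small-mapT Se len Sf =
    small-foldrT Se small-empty len (λ x∈ → small-▹ (small-wk (Sf x∈)) small-var)

  small-filterT : ∀ {Γ σ} {e : Tm Γ (list σ)} {p : Tm (σ ∷ Γ) bool} {ρ} → Small X e ρ →
      length (⟦ e ⟧ ρ) ≤ X →
    (∀ {x} → x ∈ ⟦ e ⟧ ρ → Small X p (x ∷ ρ)) → Small X (filterT e p) ρ
  small-filterT Se len Sp = small-foldrT Se small-empty len
    (λ x∈ → small-ite (small-wk (Sp x∈)) (small-▹ small-var small-var) small-var)

  length-zipT : ∀ {Γ σ τ} (e : Tm Γ (list σ)) (f : Tm Γ (list τ)) {ρ} → length (⟦ e ⟧ ρ) ≤ X →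
                length (⟦ zipT e f ⟧ ρ) ≤ X
  length-zipT e f {ρ} len = ≤-trans (≤-reflexive (trans (cong length (zipT-correct e f ρ))
    (length-zipWith _,_ (⟦ e ⟧ ρ) (⟦ f ⟧ ρ)))) (≤-trans (m⊓n≤m _ _) len)

  small-zipT : ∀ {Γ σ τ} {e : Tm Γ (list σ)} {f : Tm Γ (list τ)} {ρ} → Small X e ρ → Small X f ρ →
               length (⟦ e ⟧ ρ) ≤ X → Small X (zipT e f) ρ
  small-zipT {Γ} {σ} {τ} {e} {f} {ρ} Se Sf len = small-reverseT
    (small-fst (small-fold Se (small-pair small-empty Sf) len
      (small-loop (λ _ → ⊤) (⟦ e ⟧ ρ) (λ _ _ → small-loopFree body refl , tt) tt)))
    (≤-trans (≤-reflexive (sym (length-reverse (⟦ fst zipping ⟧ ρ)))) (length-zipT e f len))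
    where
    body : Tm (σ ∷ (list (σ ⊗ τ) ⊗ list τ) ∷ Γ) (list (σ ⊗ τ) ⊗ list τ)
    body = uncons (snd v1) v1 (pair (pair v2 v0 ▹ fst v3) v1)
    zipping : Tm Γ (list (σ ⊗ τ) ⊗ list τ)
    zipping = fold e (pair empty f) body

  small-identityT : ∀ M → length M ≤ X → Small X identityT (M ∷ [])
  small-identityT M len = small-fold small-var small-empty len
    (go M 0 (≤-trans (≤-reflexive (+-identityʳ (length M))) len))
    where
    -- The sum `length xs + i` is constant along the loop, so no intermediate matrix has more than
    -- `X` rows.
    go : ∀ xs i → length xs + i ≤ X →
         SmallLoop (λ a x → Small X identityStepT (x ∷ a ∷ M ∷ []))
                   (λ a x → ⟦ identityStepT ⟧ (x ∷ a ∷ M ∷ [])) (identity i) xs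
    go []       i le = tt
    go (x ∷ xs) i le =
      small-▹ (small-▹ small-bit (small-mapT small-var short (λ _ → small-bit)))
              (small-mapT small-var short (λ _ → small-▹ small-bit small-var)) ,
      subst (λ a → SmallLoop (λ a x → Small X identityStepT (x ∷ a ∷ M ∷ []))
                     (λ a x → ⟦ identityStepT ⟧ (x ∷ a ∷ M ∷ [])) a xs)
        (sym (identityStepT-correct i x M))
        (go xs (suc i) (≤-trans (≤-reflexive (+-suc (length xs) i)) le))
      where
      short : length (identity i) ≤ X
      short = ≤-trans (≤-reflexive (length-tabulate (λ u → tabulate (λ v → does (u ≟ᶠ v)))))
                (≤-trans (≤-trans (m≤n+m i (length xs)) (n≤1+n _)) le)

  small-selectT : ∀ D E → length D ≤ X → Small X selectT (D ∷ E ∷ [])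
  small-selectT D E len = small-mapT
    (small-filterT (small-zipT small-var small-var len) (length-zipT v0 v1 {ρ} len)
        (λ _ → small-fst small-var))
    (≤-trans (≤-reflexive (cong length (filterT-correct (zipT v0 v1) (fst v0) ρ)))
      (≤-trans (length-filterᵇ proj₁ (⟦ zipT v0 v1 ⟧ ρ)) (length-zipT v0 v1 {ρ} len)))
    (λ _ → small-snd small-var)
    where
    ρ : Env (subset ∷ list trace ∷ [])
    ρ = D ∷ E ∷ []
    length-filterᵇ : ∀ {A : Set} (p : A → Bool) xs → length (filterᵇ p xs) ≤ length xs
    length-filterᵇ p xs = ≤-trans (m≤m+n _ _) (≤-reflexive (sym (length-split p xs)))

bitLists : ℕ → List (List Bool)
bitLists = listsUpTo (true ∷ false ∷ [])

∈-bitLists : ∀ {m} xs → length xs ≤ m → xs ∈ bitLists m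
∈-bitLists xs len = ∈-listsUpTo len (All.tabulate (λ {b} _ → bit∈ b))
  where
  bit∈ : ∀ b → b ∈ true ∷ false ∷ []
  bit∈ true  = here refl
  bit∈ false = there (here refl)

-- The successor allows for the vertex under test, which is prepended before it is accepted or
-- rejected. The three summands of `valueBound` bound the length of a trace, the number of distinct
-- traces, and the length of a tuple or of the unary `k`.
coreSize valueBound : ℕ → ℕ → ℕ
coreSize d k   = suc (coreBound d k d)
valueBound d k = coreSize d k + (length (bitLists (coreSize d k)) + k)

module Resources (G : Graph) (d k : ℕ) (excludes : ¬ (completeBipartite d d IsSubgraphOf G)) where
  open Graph G
  open Biclique G using (skew-bound; closed)
  open Traces closed
  open Skewness closed k using (Skew)
  open Correctness G

  bounded-trace : ∀ {xs : List Bool} → length xs ≤ (valueBound d k) → Bounded (valueBound d k) trace xs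
  bounded-trace {xs} len = len , All.tabulate (λ _ → tt)

  bounded-column : ∀ {xs : List Bool} → length xs ≤ coreSize d k → Bounded (valueBound d k) trace xs
  bounded-column len = bounded-trace (≤-trans len (m≤m+n (coreSize d k) _))

  bounded-traces : ∀ {L} → Unique L → (∀ {x} → x ∈ L → length x ≤ coreSize d k) →
      Bounded (valueBound d k) (list trace) L
  bounded-traces {L} unique short =
    ≤-trans (unique-⊆⇒length-≤ unique (λ x∈ → ∈-bitLists _ (short x∈)))
      (≤-trans (m≤m+n _ k) (m≤n+m _ (coreSize d k))) ,
    All.tabulate (λ x∈ → bounded-column (short x∈))

  core-length : ∀ {cs} → Skew cs → suc (length cs) ≤ coreSize d k
  core-length skew = s≤s (skew-bound d k excludes d skew [] refl (λ _ ()))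

  column-length : ∀ cs {x} → x ∈ columns cs → length x ≡ length cs
  column-length cs x∈ with ∈-map⁻ (column cs) x∈
  ... | w , _ , refl = length-map (λ c → closed c w) cs

  bounded-dedup : ∀ cs → length cs ≤ coreSize d k → Bounded (valueBound d k) (list trace)
      (dedup (columns cs))
  bounded-dedup cs len = bounded-traces (dedup-unique (columns cs))
    (λ x∈ → ≤-trans (≤-reflexive (column-length cs (∈-dedup⁻ (columns cs) x∈))) len)

  module _ (X : ℕ) (order≤X : order ≤ X)
           (member≤X : worstTime memberT (valueBound d k) ≤ X)
           (misses≤X : worstTime missesT (valueBound d k) ≤ X)
           (reachable≤X : worstTime reachableT (valueBound d k) ≤ X)
           (ks : List Bool) (ks-length : length ks ≡ k) where

    length-map-vertices : ∀ {B : Set} (f : Vertex → B) → length (map f vertices) ≤ X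
    length-map-vertices f = ≤-trans
        (≤-reflexive (trans (length-map f vertices) (length-tabulate (λ i → i)))) order≤X

    -- The loop runs over all vertices, but its accumulator consists of distinct short bit lists, so
    -- each membership test falls under the worst-case time for bounded values.
    small-dedupT : ∀ cs → length cs ≤ coreSize d k → Small X dedupT (columns cs ∷ [])
    small-dedupT cs len = small-fold small-var small-empty (length-map-vertices (column cs))
      (small-loop (λ L → Unique L × (∀ {x} → x ∈ L → length x ≤ coreSize d k)) (columns cs) step
          ([] , λ ()))
      where
      short : ∀ {x} → x ∈ columns cs → length x ≤ coreSize d k
      short x∈ = ≤-trans (≤-reflexive (column-length cs x∈)) len
      step : ∀ {L x} → x ∈ columns cs → Unique L × (∀ {y} → y ∈ L → length y ≤ coreSize d k) →
             Small X (ite (app memberT (i0 ∷ i1 ∷ [])) v1 (v0 ▹ v1))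
                     (_∷_ {P = Val} {x = trace} x (_∷_ {x = list trace} L (columns cs ∷ [])))
             × Unique (dedupStep L x) × (∀ {y} → y ∈ dedupStep L x → length y ≤ coreSize d k)
      step {L} {x} x∈ (unique , shortL) =
        small-ite (small-time (≤-trans (time≤worstTime memberT
            (bounded-column (short x∈) , bounded-traces unique shortL , tt)) member≤X))
          small-var (small-▹ small-var small-var) ,
        dedupStep-unique x unique ,
        λ y∈ → lengths (∈-dedupStep⁻ x y∈)
        where
        lengths : ∀ {y} → y ∈ L ⊎ y ≡ x → length y ≤ coreSize d k
        lengths (inj₁ y∈)   = shortL y∈
        lengths (inj₂ refl) = short x∈

    small-closedT : Small X closedT (rows (λ u v → does (u ≟ᶠ v)) ∷ rows adjacent ∷ [])
    small-closedT = small-mapT X (small-zipT X small-var small-var (length-map-vertices _))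
      (length-zipT X v0 v1 {ρ} (length-map-vertices _)) row
      where
      δ : Vertex → Vertex → Bool
      δ u v = does (u ≟ᶠ v)
      ρ : Env (matrix ∷ matrix ∷ [])
      ρ = rows δ ∷ rows adjacent ∷ []
      row : ∀ {x} → x ∈ ⟦ zipT v0 v1 ⟧ ρ → Small X closedRowT (x ∷ ρ)
      row {x} x∈ with ∈-map⁻ _ (subst (x ∈_) (trans (zipT-correct v0 v1 ρ) (zip-map _ _ vertices)) x∈)
      ... | u , _ , refl = small-mapT X
        (small-zipT X (small-fst small-var) (small-snd small-var) (length-map-vertices (δ u)))
        (length-zipT X (fst v0) (snd v0) {(map (δ u) vertices , map (adjacent u) vertices) ∷ ρ}
            (length-map-vertices (δ u)))
        (λ _ → small-ite (small-fst small-var) small-bit (small-snd small-var))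

    -- In every round the accumulator is `columns cs` for a skew `cs`, which the excluded biclique
    -- keeps short. After removal of duplicates `missesT` thus receives bounded values, and what
    -- remains are loops over the vertices.
    small-tracesT : Small X tracesT (rows closed ∷ ks ∷ [])
    small-tracesT = small-fold small-var (small-mapT X small-var rows-short (λ _ → small-empty))
        rows-short
      (small-loop Invariant (rows closed) step start)
      where
      rows-short : length (rows closed) ≤ X
      rows-short = length-map-vertices _
      Invariant : List (List Bool) → Set
      Invariant E = ∃[ done ] ∃[ cs ] E ≡ columns cs × Core ks done cs
      start : Invariant (⟦ mapT v0 empty ⟧ (rows closed ∷ ks ∷ []))
      start = [] , [] , tracesT-start ks , core Skewness.[] (λ _ _ _ ())
      step : ∀ {E r} → r ∈ rows closed → Invariant E →
             Small X coreStepT (r ∷ E ∷ rows closed ∷ ks ∷ []) ×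
             Invariant (⟦ coreStepT ⟧ (r ∷ E ∷ rows closed ∷ ks ∷ []))
      step r∈ (done , cs , refl , c) with ∈-map⁻ _ r∈ | subst (λ k → Skewness.Skew closed k cs)
          ks-length (Core.skew c)
      ... | v , _ , refl | skew = small-step , v ∷ done , coreStepT-correct ks v (rows closed) c
        where
        ρ : Env (trace ∷ list trace ∷ matrix ∷ nat ∷ [])
        ρ = map (closed v) vertices ∷ columns cs ∷ rows closed ∷ ks ∷ []
        small-step : Small X coreStepT ρ
        small-step = small-bind
          (small-mapT X (small-zipT X small-var small-var (length-map-vertices (closed v)))
            (length-zipT X v0 v1 {ρ} (length-map-vertices (closed v)))
                (λ _ → small-▹ (small-fst small-var) (small-snd small-var)))
          (extendT-correct v cs (rows closed) ks)
          (small-bind (small-app (small-dedupT (v ∷ cs) (core-length skew))) refl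
          (small-ite (small-time (≤-trans (time≤worstTime missesT
             (bounded-dedup (v ∷ cs) (core-length skew) ,
              bounded-trace (≤-trans (≤-reflexive ks-length)
                  (≤-trans (m≤n+m k _) (m≤n+m _ (coreSize d k)))) , tt)) misses≤X))
            small-var small-var))

    bounded-selection : ∀ {cs} (D : Subset order) → Skew cs → ∣ D ∣ ≡ k →
                        Bounded (valueBound d k) (list trace) (map (column cs) (elements D))
    bounded-selection {cs} D skew size =
      ≤-trans (≤-reflexive (trans (length-map (column cs) (elements D))
          (trans (length-elements D) size)))
        (≤-trans (m≤n+m k _) (m≤n+m _ (coreSize d k))) ,
      All.tabulate bounded
      where
      bounded : ∀ {x} → x ∈ map (column cs) (elements D) → Bounded (valueBound d k) trace x
      bounded x∈ with ∈-map⁻ (column cs) x∈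
      ... | w , _ , refl = bounded-column (≤-trans (≤-reflexive (length-map (λ c → closed c w) cs))
                             (≤-trans (n≤1+n _) (core-length skew)))

    opaque
      unfolding decideT

      small-decideT′ : ∀ {cs} Ds Dt → ∣ Ds ∣ ≡ k → ∣ Dt ∣ ≡ k →
        ⟦ tracesT ⟧ (rows closed ∷ ks ∷ []) ≡ columns cs → Skew cs →
        Small X decideT (rows adjacent ∷ ks ∷ map (Vec.lookup Ds) vertices
            ∷ map (Vec.lookup Dt) vertices ∷ [])
      small-decideT′ {cs} Ds Dt sizeS sizeT eq skew =
        small-bind (small-app (small-identityT X (rows adjacent) (length-map-vertices _))) identityT-rows
        (small-bind (small-app small-closedT) closedT-correct
        (small-bind (small-app small-tracesT) eq
        (small-bind (small-app (small-selectT X (map (Vec.lookup Ds) vertices) (columns cs)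
            (length-map-vertices _)))
          (selectT-correct Ds (column cs))
        (small-bind (small-app (small-selectT X (map (Vec.lookup Dt) vertices) (columns cs)
            (length-map-vertices _)))
          (selectT-correct Dt (column cs))
        (small-bind (small-app (small-dedupT cs short)) refl
        (small-time (≤-trans (time≤worstTime reachableT
          (bounded-dedup cs short , bounded-selection Ds skew sizeS ,
              bounded-selection Dt skew sizeT , tt))
          reachable≤X)))))))
        where
        short : length cs ≤ coreSize d k
        short = ≤-trans (n≤1+n _) (core-length skew)

    small-decideT : ∀ Ds Dt → ∣ Ds ∣ ≡ k → ∣ Dt ∣ ≡ k →
      Small X decideT (rows adjacent ∷ ks ∷ map (Vec.lookup Ds) vertices
          ∷ map (Vec.lookup Dt) vertices ∷ [])
    small-decideT Ds Dt sizeS sizeT with tracesT-correct ks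
    ... | cs , eq , core skew _ =
      small-decideT′ Ds Dt sizeS sizeT eq (subst (λ k → Skewness.Skew closed k cs) ks-length skew)

-- From a decision term to fixed-parameter tractability

size>0 : ∀ t → 1 ≤ size t
size>0 nil     = ≤-refl
size>0 (s ∙ t) = s≤s z≤n

*-^ : ∀ m n i → (m * n) ^ i ≡ m ^ i * n ^ i
*-^ m n zero    = refl
*-^ m n (suc i) = trans (cong (m * n *_) (*-^ m n i)) ([m*n]*[o*p]≡[m*o]*[n*p] m n (m ^ i) (n ^ i))

reflects : ∀ {P : Set} b → (b ≡ true → P) → (P → b ≡ true) → Reflects P b
reflects true  sound complete = ofʸ (sound refl)
reflects false sound complete = ofⁿ λ p → false≢true (complete p)
  where false≢true : false ≢ true
        false≢true ()

module _ (P : ParameterizedProblem) where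
  open ParameterizedProblem P

  -- With X = q · N, the power X^c is q^c · N^c, where `c` depends on the program alone. The
  -- exponent exceeds `degree e` by one to pay for copying the result from location 1 to location 0.
  decides⇒fpt : ∀ {τ} (e : Tm (τ ∷ []) bool) (value : Instance → Val τ) →
    (∀ x → enc τ (value x) ≡ encode x ∙ encodeℕ (parameter x)) →
    (Q : ℕ → ℕ) → (∀ p → 20 ≤ Q p) →
    (∀ x → Small (Q (parameter x) * size (encode x)) e (value x ∷ [])) →
    (∀ x → Reflects (Yes x) (⟦ e ⟧ (value x ∷ []))) →
    FixedParameterTractable P
  decides⇒fpt {τ} e value encodes Q 20≤Q small correct =
    compile e (0 ∷ []) 1 ⨾ 0 ≔ var 1 , (λ p → Q p ^ c) , c , decide
    where
    c = suc (degree e)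

    decide : ∀ x → _
    decide x with compile-correct e {value x ∷ []} {0 ∷ []} {1}
        {initial (encode x ∙ encodeℕ (parameter x))}
                    ((s≤s z≤n , sym (encodes x)) ∷ [])
    ... | runs {final} run _ result =
      final [ 0 ↦ final 1 ] , time e (value x ∷ []) + 2 , ⟦ e ⟧ (value x ∷ []) ,
      seq run assign , trans (update-same final 0 (final 1)) result , correct x , in-time
      where
      open ≤-Reasoning
      N = size (encode x)
      q = Q (parameter x)
      X = q * N
      20≤X : 20 ≤ X
      20≤X = ≤-trans (≤-reflexive (sym (*-identityʳ 20)))
          (*-mono-≤ (20≤Q (parameter x)) (size>0 (encode x)))
      in-time : time e (value x ∷ []) + 2 ≤ q ^ c * N ^ c
      in-time = begin
        time e (value x ∷ []) + 2    ≤⟨ final-assignment (X ^ degree e) 20≤X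
            (pow-positive X (degree e) 20≤X) (time-bound X 20≤X e (small x)) ⟩
        X ^ c                        ≡⟨ *-^ q N c ⟩
        q ^ c * N ^ c                ∎
        where
        pow-positive : ∀ X i → 20 ≤ X → 1 ≤ X ^ i
        pow-positive (suc X) i _ = m^n>0 (suc X) i
        final-assignment : ∀ {t X} Y → 20 ≤ X → 1 ≤ Y → t ≤ Y → t + 2 ≤ X * Y
        final-assignment {t} {X} Y 20≤X 1≤Y t≤Y = begin
          t + 2      ≤⟨ +-monoʳ-≤ t (*-mono-≤ (m≤m+n 2 17) 1≤Y) ⟩
          t + 19 * Y ≤⟨ +-monoˡ-≤ (19 * Y) t≤Y ⟩
          20 * Y     ≤⟨ *-monoˡ-≤ Y 20≤X ⟩
          X * Y      ∎

-- `encodeBool false` is `nil`, so a list of `false` has the same tree as the numeral.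
unary : ℕ → List Bool
unary n = replicate n false

enc-unary : ∀ n → enc nat (unary n) ≡ encodeℕ n
enc-unary zero    = refl
enc-unary (suc n) = cong (nil ∙_) (enc-unary n)

enc-map : ∀ {A B : Set} (f : B → Tree) (g : A → B) xs → encodeList f (map g xs) ≡ encodeList (f ∘ g) xs
enc-map f g []       = refl
enc-map f g (x ∷ xs) = cong (f (g x) ∙_) (enc-map f g xs)

encodeList-cong : ∀ {A : Set} {f g : A → Tree} → (∀ x → f x ≡ g x) → ∀ xs → encodeList f xs
    ≡ encodeList g xs
encodeList-cong f≡g []       = refl
encodeList-cong f≡g (x ∷ xs) = cong₂ _∙_ (f≡g x) (encodeList-cong f≡g xs)

enc-graph : ∀ G → enc matrix (Correctness.rows G (Graph.adjacent G)) ≡ encodeGraph G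
enc-graph G = trans (enc-map (encodeList encodeBool) (λ u → map (adjacent u) (allFin order))
    (allFin order))
  (encodeList-cong (λ u → enc-map encodeBool (adjacent u) (allFin order)) (allFin order))
  where open Graph G

enc-subset : ∀ {n} (D : Subset n) → enc subset (map (Vec.lookup D) (allFin n)) ≡ encodeSubset D
enc-subset D = cong (encodeList encodeBool) (trans (map-tabulate id (Vec.lookup D)) (toList-tabulate D))
  where
  toList-tabulate : ∀ {n} (D : Subset n) → tabulate (Vec.lookup D) ≡ Vec.toList D
  toList-tabulate []      = refl
  toList-tabulate (b ∷ D) = cong (b ∷_) (toList-tabulate D)

length≤size : ∀ {A : Set} (f : A → Tree) xs → length xs ≤ size (encodeList f xs)
length≤size f []       = z≤n
length≤size f (x ∷ xs) = s≤s (≤-trans (length≤size f xs) (m≤n+m _ (size (f x))))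

order≤size : ∀ I → Graph.order (DSRInstance.G I) ≤ size (encodeDSR I)
order≤size I = ≤-trans (≤-reflexive (sym (length-tabulate (λ (i : Fin order) → i))))
  (≤-trans (length≤size (λ u → encodeList (λ v → encodeBool (adjacent u v)) (allFin order))
      (allFin order))
  (≤-trans (m≤m+n _ _) (n≤1+n _)))
  where open Graph (DSRInstance.G I)

bruteForceTime : ℕ × ℕ → ℕ
bruteForceTime (d , k) = 20 + (worstTime memberT s + (worstTime missesT s + worstTime reachableT s))
  where s = valueBound d k

opaque
  -- The time function may depend on the sum k+d only, while the brute-force times depend on `d` and
  -- `k` separately. Summing over all pairs with both entries at most `p` dominates each of them.
  parameterBound : ℕ → ℕ
  parameterBound p = 20 + sum (map bruteForceTime (cartesianProduct (upTo (suc p)) (upTo (suc p))))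

  bruteForceTime≤parameterBound : ∀ d k → bruteForceTime (d , k) ≤ parameterBound (k + d)
  bruteForceTime≤parameterBound d k = ≤-trans
    (∈⇒≤sum (∈-map⁺ bruteForceTime
        (∈-cartesianProduct⁺ (∈-upTo⁺ (s≤s (m≤n+m d k))) (∈-upTo⁺ (s≤s (m≤m+n k d))))))
    (m≤n+m _ 20)

  20≤parameterBound : ∀ p → 20 ≤ parameterBound p
  20≤parameterBound p = m≤m+n 20 _

module _ (I : DSRInstance) where
  open DSRInstance I
  open Correctness G

  instanceValue : Val input
  instanceValue =
    (rows (Graph.adjacent G) , unary d , unary k , map (Vec.lookup Ds) vertices , map
        (Vec.lookup Dt) vertices) ,
    unary (k + d)

  enc-instance : enc input instanceValue ≡ encodeDSR I ∙ encodeℕ (k + d)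
  enc-instance = cong₂ _∙_
    (cong₂ _∙_ (enc-graph G) (cong₂ _∙_ (enc-unary d) (cong₂ _∙_ (enc-unary k)
      (cong₂ _∙_ (enc-subset Ds) (enc-subset Dt)))))
    (enc-unary (k + d))

  small-mainT : Small (parameterBound (k + d) * size (encodeDSR I)) mainT (instanceValue ∷ [])
  small-mainT =
    small-bind (small-fst small-var) refl
    (small-bind (small-fst small-var) refl
    (small-bind (small-snd small-var) refl
    (small-bind (small-snd small-var) refl
    (small-bind (small-fst small-var) refl
    (small-bind (small-snd small-var) refl
    (small-bind (small-fst small-var) refl
    (small-bind (small-snd small-var) refl
    (small-app (Resources.small-decideT G d k excludes X order≤X
      (≤-trans (≤-trans (m≤m+n _ _) (m≤n+m _ 20)) brute≤X)
      (≤-trans (≤-trans (≤-trans (m≤m+n _ _) (m≤n+m _ (worstTime memberT s))) (m≤n+m _ 20)) brute≤X)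
      (≤-trans (≤-trans (≤-trans (m≤n+m _ (worstTime missesT s)) (m≤n+m _ (worstTime memberT s)))
          (m≤n+m _ 20)) brute≤X)
      (unary k) (length-replicate k) Ds Dt Ds-size Dt-size)))))))))
    where
    s = valueBound d k
    X = parameterBound (k + d) * size (encodeDSR I)
    order≤X : Graph.order G ≤ X
    order≤X = ≤-trans (order≤size I)
      (m≤n*m (size (encodeDSR I)) (parameterBound (k + d))
        {{>-nonZero (≤-trans (m≤m+n 1 19) (20≤parameterBound (k + d)))}})
    brute≤X : bruteForceTime (d , k) ≤ X
    brute≤X = ≤-trans (bruteForceTime≤parameterBound d k)
      (m≤m*n (parameterBound (k + d)) (size (encodeDSR I)) {{>-nonZero (size>0 (encodeDSR I))}})

  mainT-correct : Reflects (Reachable G k Ds Dt) (⟦ mainT ⟧ (instanceValue ∷ []))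
  mainT-correct = go k k-positive refl
    where
    go : ∀ k₁ → 0 < k₁ → k ≡ k₁ → Reflects (Reachable G k Ds Dt) (decision (unary k) Ds Dt)
    go (suc k′) _ k≡ with decideT-correct (unary k) k′ Ds Dt (trans (length-replicate k) k≡)
                            Ds-dominating Dt-dominating (trans Ds-size k≡) (trans Dt-size k≡)
    ... | sound , complete = reflects (decision (unary k) Ds Dt)
      (λ eq → subst (λ k → Reachable G k Ds Dt) (sym k≡) (sound eq))
      (λ path → complete (subst (λ k → Reachable G k Ds Dt) k≡ path))

theorem9 : FixedParameterTractable BicliqueFreeDSR
theorem9 = decides⇒fpt BicliqueFreeDSR mainT instanceValue enc-instance
  parameterBound 20≤parameterBound small-mainT mainT-correct
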